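{- For every integer $r\ge 3$ there is a constant $c_r>0$ such that every $K_r$-free $d$-degenerate graph $G$ with $m$ edges (where $d\ge 1$) satisfies $\mathrm{sp}(G)\ge c_r\, m/d^{1-1/(r-1)}$.
   Context: All graphs are finite and simple. A graph is $d$-degenerate if every subgraph has a vertex of degree at most $d$. A graph is $K_r$-free if it has no complete subgraph on $r$ vertices. $\mathrm{mc}(G)$ denotes the maximum number of edges crossing a partition of $V(G)$ into two parts, and $\mathrm{sp}(G)=\mathrm{mc}(G)-e(G)/2$. -}

module Defs where

open import Data.Nat using (ℕ; zero; suc; _+_; _*_; _∸_; _^_; _≤_; _<_; _⊔_; _<ᵇ_)
open import Data.Bool using (Bool; true; false; if_then_else_; _∧_; _xor_; T)
open import Data.Fin using (Fin; zero; suc; toℕ)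
open import Data.List using (List; []; _∷_; map; concatMap; foldr)
open import Data.Product using (Σ; _×_; _,_; ∃)
open import Relation.Binary.PropositionalEquality using (_≡_; _≢_)
open import Function.Definitions using (Injective)

record Graph (n : ℕ) : Set where
  field
    adj    : Fin n → Fin n → Bool
    sym    : ∀ u v → adj u v ≡ adj v u
    irrefl : ∀ v → adj v v ≡ false
open Graph public

count : ∀ {n} → (Fin n → Bool) → ℕ
count {zero}  f = 0
count {suc n} f = (if f zero then 1 else 0) + count (λ i → f (suc i))

sumF : ∀ {n} → (Fin n → ℕ) → ℕ
sumF {zero}  g = 0
sumF {suc n} g = g zero + sumF (λ i → g (suc i))

countPairs : ∀ {n} → (Fin n → Fin n → Bool) → ℕ
countPairs R = sumF (λ u → count (λ v → (toℕ u <ᵇ toℕ v) ∧ R u v))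

edges : ∀ {n} → Graph n → ℕ
edges G = countPairs (adj G)

cut : ∀ {n} → Graph n → (Fin n → Bool) → ℕ
cut G P = countPairs (λ u v → adj G u v ∧ (P u xor P v))

allParts : (n : ℕ) → List (Fin n → Bool)
allParts zero    = (λ ()) ∷ []
allParts (suc n) = concatMap (λ P → ext false P ∷ ext true P ∷ []) (allParts n)
  where
  ext : Bool → (Fin n → Bool) → Fin (suc n) → Bool
  ext b P zero    = b
  ext b P (suc i) = P i

mc : ∀ {n} → Graph n → ℕ
mc {n} G = foldr _⊔_ 0 (map (cut G) (allParts n))

KrFree : ℕ → ∀ {n} → Graph n → Set
KrFree r {n} G =
  (f : Fin r → Fin n) → Injective _≡_ _≡_ f →
  Σ (Fin r) λ i → Σ (Fin r) λ j → i ≢ j × adj G (f i) (f j) ≡ false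

record Subgraph {n : ℕ} (G : Graph n) : Set where
  field
    S      : Fin n → Bool
    H      : Fin n → Fin n → Bool
    Hsym   : ∀ u v → H u v ≡ H v u
    Hsub   : ∀ u v → H u v ≡ true → adj G u v ≡ true
    Hvert  : ∀ u v → H u v ≡ true → S u ≡ true
open Subgraph public

Degenerate : ℕ → ∀ {n} → Graph n → Set
Degenerate d {n} G =
  (K : Subgraph G) → Σ (Fin n) (λ v → S K v ≡ true) →
  Σ (Fin n) λ v → S K v ≡ true × count (H K v) ≤ d

{-# OPTIONS --safe #-}
module Submission where

-- Orient G with indegrees at most d and let the surplus of a vector z be minus the sum of z u * z v over the
-- edges; it is at most 2 mc G - e for |z| ≤ 1.
-- By induction on r, a * #{v : indegree v ≥ a ^ (r - 1)} is at most a constant times the surplus whenever there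
-- is no transitive tournament on r vertices, and summing over a = 1, 2, 4, … gives the theorem.
-- For the induction step let every vertex v of indegree at least s = a ^ (r - 1) choose s in-neighbours A v,
-- and set t = a ^ (r - 2).
-- Pairs w ∈ A v for which fewer than 2 t in-neighbours u of v have w ∈ A u are exploited by random signs: half
-- of the vertices get random signs and the others oppose the clipped sum of the signs they chose.
-- For the other pairs sample vertices with probability about 1 / s; the vertices v whose only sampled choice is
-- w form disjoint clusters inside the out-neighbourhoods of the sampled w, to which the induction hypothesis
-- applies.

open import Defs hiding (sym; S; H; Hsym; Hsub; Hvert)
open import Data.Bool using (Bool; true; false; _∧_; _xor_; not; if_then_else_)
import Data.Bool.Properties as Bool
open import Data.Empty using (⊥-elim)
open import Data.Fin using (Fin; zero; suc; toℕ)
import Data.Fin.Properties as Fin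
open import Data.Integer hiding (suc; _◂_; _◃_)
open import Data.Integer.Properties
open import Data.Integer.Tactic.RingSolver using (solve-∀)
import Data.List as List
open import Data.List.Relation.Unary.Any using (Any; here; there)
import Data.List.Relation.Unary.Any as Any
import Data.List.Relation.Unary.Any.Properties as Any
open import Data.Nat as ℕ using (ℕ; zero; suc; z≤n)
import Data.Nat.Properties as ℕ
import Data.Nat.Tactic.RingSolver as ℕ-Solver
open import Data.Product using (Σ; ∃; _×_; _,_; proj₁; proj₂)
open import Data.Sum using (_⊎_; inj₁; inj₂)
open import Data.Unit using (⊤; tt)
open import Data.Vec using (Vec; []; _∷_; lookup; map)
open import Data.Vec.Functional using () renaming (_∷_ to _◂_)
open import Data.Vec.Properties using (lookup-map)
open import Function using (_∘_)
open import Function.Definitions using (Injective)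
open import Relation.Binary.PropositionalEquality
open import Relation.Nullary using (¬_; Dec; yes; no; does)
open import Relation.Nullary.Decidable using (dec-true)
open import Algebra.Properties.Semiring.Sum +-*-semiring using (sum-cong-≗; ∑-distrib-+; ∑-comm; *-distribˡ-sum; *-distribʳ-sum) renaming (sum to ∑)

-- The scales `t` and `s = a * t` make both branches pay the same. Let `U` be the number of vertices
-- of indegree at least `s`, so that about `s * U` pairs are chosen. Signs clipped at a level `M` of
-- order `t` gain about `M` per chosen pair, and rescaling to unit vectors divides by `M * M`: the
-- surplus is of order `s * U / t = a * U`. The obstacle is an adjacent pair of vertices opposing a
-- common source. Such a pair may be positively correlated, and the loss stays below the gain only
-- if each chosen pair lies in at most about `t` triangles of this kind. For the other pairs the
-- triangles are an asset: a pair survives the sampling, with indegree at least `t` inside its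
-- cluster, with probability at least `1 / (12 s)`, so about `U` vertices are available to the
-- induction hypothesis for the same `a`, which again pays `a * U`. Degeneracy enters only in the
-- summation over `a`; the inductive claim is therefore free of `d` and can be passed on to clusters
-- unchanged.

private variable n : ℕ

-- Integer inequalities and finite sums

⟦_⟧ : Bool → ℤ
⟦ true ⟧ = 1ℤ
⟦ false ⟧ = 0ℤ

+-congˡ : ∀ x {y z} → y ≡ z → x + y ≡ x + z
+-congˡ x = cong (λ t → x + t)

infixl 6 _⊕_
infixl 7 _⊗_

_⊕_ : ∀ {x y} → 0ℤ ≤ x → 0ℤ ≤ y → 0ℤ ≤ x + y
_⊕_ = +-mono-≤

_⊗_ : ∀ {x y} → 0ℤ ≤ x → 0ℤ ≤ y → 0ℤ ≤ x * y
_⊗_ {x} {y} p q = subst (_≤ x * y) (*-zeroʳ x) (*-monoˡ-≤-nonNeg x {{nonNegative p}} q)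

pos≥0 : ∀ {k} → 0ℤ ≤ + k
pos≥0 = +≤+ z≤n

pos>0 : ∀ {k} → 0ℤ < + suc k
pos>0 = +<+ (ℕ.s≤s z≤n)

gap : ∀ {x y} → x ≤ y → 0ℤ ≤ y - x
gap = i≤j⇒0≤j-i

-- An inequality is certified by writing the difference of its two sides as a nonnegative expression.
certify : ∀ {x y e} → y - x ≡ e → 0ℤ ≤ e → x ≤ y
certify eq p = 0≤i-j⇒j≤i (subst (0ℤ ≤_) (sym eq) p)

cancel-pos : ∀ {c x y} → 0ℤ < c → c * x ≤ c * y → x ≤ y
cancel-pos {c} {x} {y} p = *-cancelˡ-≤-pos x y c {{positive p}}

scale : ∀ {c x y} → 0ℤ ≤ c → x ≤ y → c * x ≤ c * y
scale {c} p = *-monoˡ-≤-nonNeg c {{nonNegative p}}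

sq≥0 : ∀ x → 0ℤ ≤ x * x
sq≥0 x with ≤-total 0ℤ x
... | inj₁ p = p ⊗ p
... | inj₂ p = subst (0ℤ ≤_) (lemma x) (neg-mono-≤ p ⊗ neg-mono-≤ p)
  where
  lemma : ∀ x → - x * - x ≡ x * x
  lemma = solve-∀

⟦⟧≥0 : ∀ b → 0ℤ ≤ ⟦ b ⟧
⟦⟧≥0 true = pos≥0
⟦⟧≥0 false = pos≥0

⟦⟧≤1 : ∀ b → ⟦ b ⟧ ≤ 1ℤ
⟦⟧≤1 true = ≤-refl
⟦⟧≤1 false = pos≥0

∑-mono : {f g : Fin n → ℤ} → (∀ i → f i ≤ g i) → ∑ f ≤ ∑ g
∑-mono {zero} h = ≤-refl
∑-mono {suc n} h = +-mono-≤ (h zero) (∑-mono (h ∘ suc))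

∑≥0 : {f : Fin n → ℤ} → (∀ i → 0ℤ ≤ f i) → 0ℤ ≤ ∑ f
∑≥0 {zero} h = ≤-refl
∑≥0 {suc n} h = h zero ⊕ ∑≥0 (h ∘ suc)

∑-zero : {f : Fin n → ℤ} → (∀ i → f i ≡ 0ℤ) → ∑ f ≡ 0ℤ
∑-zero {zero} h = refl
∑-zero {suc n} h = cong₂ _+_ (h zero) (∑-zero (h ∘ suc))

∑-*ˡ : ∀ c (f : Fin n → ℤ) → ∑ (λ i → c * f i) ≡ c * ∑ f
∑-*ˡ c f = sym (*-distribˡ-sum c f)

-- Product measures on Boolean vectors

-- Expectations are kept unnormalised: each coordinate carries weight α on false and 1 on true, so the total
-- mass of Vec Bool n is (α + 1)ⁿ.
module Expectation (α : ℤ) (α≥0 : 0ℤ ≤ α) where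

  q : ℤ
  q = α + 1ℤ

  𝔼 : (Vec Bool n → ℤ) → ℤ
  𝔼 {zero} f = f []
  𝔼 {suc n} f = α * 𝔼 (f ∘ (false ∷_)) + 𝔼 (f ∘ (true ∷_))

  q>0 : 0ℤ < q
  q>0 = <-≤-trans pos>0 (certify (id α) α≥0)
    where
    id : ∀ x → x + 1ℤ - 1ℤ ≡ x
    id = solve-∀

  mass>0 : ∀ n → 0ℤ < q ^ n
  mass>0 zero = pos>0
  mass>0 (suc n) = subst (_< q * q ^ n) (*-zeroʳ q) (*-monoˡ-<-pos q {{positive q>0}} (mass>0 n))

  𝔼-cong : {f g : Vec Bool n → ℤ} → (∀ y → f y ≡ g y) → 𝔼 f ≡ 𝔼 g
  𝔼-cong {zero} h = h []
  𝔼-cong {suc n} h = cong₂ (λ a b → α * a + b) (𝔼-cong (h ∘ (false ∷_))) (𝔼-cong (h ∘ (true ∷_)))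

  𝔼-mono : {f g : Vec Bool n → ℤ} → (∀ y → f y ≤ g y) → 𝔼 f ≤ 𝔼 g
  𝔼-mono {zero} h = h []
  𝔼-mono {suc n} h = +-mono-≤ (scale α≥0 (𝔼-mono (h ∘ (false ∷_)))) (𝔼-mono (h ∘ (true ∷_)))

  𝔼-const : ∀ n c → 𝔼 {n} (λ _ → c) ≡ q ^ n * c
  𝔼-const zero c = sym (*-identityˡ c)
  𝔼-const (suc n) c = trans (cong₂ (λ a b → α * a + b) (𝔼-const n c) (𝔼-const n c)) (id α (q ^ n) c)
    where
    id : ∀ α m c → α * (m * c) + m * c ≡ (α + 1ℤ) * m * c
    id = solve-∀

  𝔼-+ : (f g : Vec Bool n → ℤ) → 𝔼 (λ y → f y + g y) ≡ 𝔼 f + 𝔼 g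
  𝔼-+ {zero} f g = refl
  𝔼-+ {suc n} f g = trans (cong₂ (λ a b → α * a + b) (𝔼-+ (f ∘ (false ∷_)) (g ∘ (false ∷_)))
      (𝔼-+ (f ∘ (true ∷_)) (g ∘ (true ∷_)))) (id α _ _ _ _)
    where
    id : ∀ α a b c d → α * (a + b) + (c + d) ≡ α * a + c + (α * b + d)
    id = solve-∀

  𝔼-* : ∀ c (f : Vec Bool n → ℤ) → 𝔼 (λ y → c * f y) ≡ c * 𝔼 f
  𝔼-* {zero} c f = refl
  𝔼-* {suc n} c f = trans (cong₂ (λ a b → α * a + b) (𝔼-* c (f ∘ (false ∷_))) (𝔼-* c (f ∘ (true ∷_)))) (id α c _ _)
    where
    id : ∀ α c a b → α * (c * a) + c * b ≡ c * (α * a + b)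
    id = solve-∀

  𝔼-∑ : ∀ {m} (f : Fin m → Vec Bool n → ℤ) → 𝔼 (λ y → ∑ λ i → f i y) ≡ ∑ λ i → 𝔼 (f i)
  𝔼-∑ {n} {zero} f = trans (𝔼-const n 0ℤ) (*-zeroʳ (q ^ n))
  𝔼-∑ {n} {suc m} f = trans (𝔼-+ (f zero) (λ y → ∑ λ i → f (suc i) y)) (+-congˡ (𝔼 (f zero)) (𝔼-∑ (f ∘ suc)))

  -- One coordinate is fixed at a time: if the `false` half falls short of its share, the `true`
  -- half exceeds its own by at least `α` times the deficit.
  𝔼-attained : ∀ {x} (f : Vec Bool n → ℤ) → q ^ n * x ≤ 𝔼 f → ∃ λ y → x ≤ f y
  𝔼-attained {zero} {x} f h = [] , subst (_≤ f []) (*-identityˡ x) h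
  𝔼-attained {suc n} {x} f h with q ^ n * x ≤? 𝔼 (f ∘ (false ∷_))
  ... | yes p = let y , r = 𝔼-attained (f ∘ (false ∷_)) p in false ∷ y , r
  ... | no ¬p = let y , r = 𝔼-attained (f ∘ (true ∷_)) (certify (id α (q ^ n) x _ _) (gap h ⊕ α≥0 ⊗ gap (<⇒≤ (≰⇒> ¬p)))) in true ∷ y , r
    where
    id : ∀ α m x a b → b - m * x ≡ α * a + b - (α + 1ℤ) * m * x + α * (m * x - a)
    id = solve-∀

  𝔼-lookup : ∀ i (g : Bool → ℤ) → q * 𝔼 {n} (λ y → g (lookup y i)) ≡ q ^ n * (α * g false + g true)
  𝔼-lookup {suc n} zero g = trans (cong₂ (λ a b → q * (α * a + b)) (𝔼-const n (g false)) (𝔼-const n (g true)))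
      (id α (q ^ n) _ _)
    where
    id : ∀ α m a b → (α + 1ℤ) * (α * (m * a) + m * b) ≡ (α + 1ℤ) * m * (α * a + b)
    id = solve-∀
  𝔼-lookup {suc n} (suc i) g = trans (id α (𝔼 {n} (λ y → g (lookup y i))))
      (trans (cong (q *_) (𝔼-lookup {n} i g)) (sym (*-assoc q (q ^ n) _)))
    where
    id : ∀ α a → (α + 1ℤ) * (α * a + a) ≡ (α + 1ℤ) * ((α + 1ℤ) * a)
    id = solve-∀

  𝔼-lookup₂ : ∀ i j (g h : Bool → ℤ) → i ≢ j →
    q * q * 𝔼 {n} (λ y → g (lookup y i) * h (lookup y j)) ≡ q ^ n * ((α * g false + g true) * (α * h false + h true))
  𝔼-lookup₂ {suc n} zero zero g h i≢j = ⊥-elim (i≢j refl)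
  𝔼-lookup₂ {suc n} zero (suc j) g h i≢j =
    trans (cong₂ (λ a b → q * q * (α * a + b)) (𝔼-* (g false) H) (𝔼-* (g true) H))
      (trans (id₁ α (g false) (g true) (𝔼 H)) (trans (cong (λ z → q * (α * g false + g true) * z) (𝔼-lookup j h))
          (id₂ q (α * g false + g true) (q ^ n) _)))
    where
    H : Vec Bool n → ℤ
    H y = h (lookup y j)
    id₁ : ∀ α a b e → (α + 1ℤ) * (α + 1ℤ) * (α * (a * e) + b * e) ≡ (α + 1ℤ) * (α * a + b) * ((α + 1ℤ) * e)
    id₁ = solve-∀
    id₂ : ∀ q a m b → q * a * (m * b) ≡ q * m * (a * b)
    id₂ = solve-∀
  𝔼-lookup₂ {suc n} (suc i) zero g h i≢j =
    trans (cong (q * q *_) (𝔼-cong {suc n} {λ y → g (lookup y (suc i)) * h (lookup y zero)} {λ y → h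
        (lookup y zero) * g (lookup y (suc i))} λ y → *-comm (g (lookup y (suc i))) (h (lookup y zero))))
      (trans (𝔼-lookup₂ {suc n} zero (suc i) h g (i≢j ∘ sym)) (cong (q ^ suc n *_) (*-comm (α * h false + h true) _)))
  𝔼-lookup₂ {suc n} (suc i) (suc j) g h i≢j =
    trans (id α (𝔼 {n} (λ y → g (lookup y i) * h (lookup y j))))
        (trans (cong (q *_) (𝔼-lookup₂ {n} i j g h (i≢j ∘ cong suc))) (sym (*-assoc q (q ^ n) _)))
    where
    id : ∀ α a → (α + 1ℤ) * (α + 1ℤ) * (α * a + a) ≡ (α + 1ℤ) * ((α + 1ℤ) * (α + 1ℤ) * a)
    id = solve-∀

-- Covariance of functions of independent signs

Bounded : ℤ → ℤ → Set
Bounded M x = - M ≤ x × x ≤ M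

Bounded-* : ∀ {M N x y} → Bounded M x → Bounded N y → x * y ≤ M * N
Bounded-* {M} {N} {x} {y} (a , b) (c , d) = cancel-pos {+ 2} pos>0
    (certify (id M N x y) (gap b ⊗ gap c ⊕ gap a ⊗ gap d))
  where
  id : ∀ M N x y → + 2 * (M * N) - + 2 * (x * y) ≡ (M - x) * (y - - N) + (x - - M) * (N - y)
  id = solve-∀

open Expectation 1ℤ pos≥0 public using () renaming (𝔼 to 𝔼₁)

-- ℓ bounds half the effect of flipping each coordinate.
Influence : (Fin n → ℤ) → (Vec Bool n → ℤ) → Set
Influence {zero} ℓ F = ⊤
Influence {suc n} ℓ F = (∀ y → Bounded (+ 2 * ℓ zero) (F (true ∷ y) - F (false ∷ y))) ×
    (∀ b → Influence (ℓ ∘ suc) (F ∘ (b ∷_)))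

module _ where
  open Expectation 1ℤ pos≥0

  private
    𝔼-- : (f g : Vec Bool n → ℤ) → 𝔼 (λ y → f y - g y) ≡ 𝔼 f - 𝔼 g
    𝔼-- f g = trans (𝔼-+ f (λ y → - g y))
        (+-congˡ (𝔼 f) (trans (𝔼-cong λ y → sym (-1*i≡-i (g y))) (trans (𝔼-* -1ℤ g) (-1*i≡-i (𝔼 g)))))

    𝔼-Bounded : ∀ {c} {f : Vec Bool n → ℤ} → (∀ y → Bounded c (f y)) → Bounded (q ^ n * c) (𝔼 f)
    𝔼-Bounded {n} {c} {f} h =
      subst (_≤ 𝔼 f) (trans (𝔼-const n (- c)) (sym (neg-distribʳ-* (q ^ n) c))) (𝔼-mono (proj₁ ∘ h)) ,
      subst (𝔼 f ≤_) (𝔼-const n c) (𝔼-mono (proj₂ ∘ h))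

  -- The martingale differences of F and G along the coordinates are orthogonal, and the product of the i-th
  -- ones is at most ℓ i * m i.
  covariance-bound : ∀ {ℓ m} {F G : Vec Bool n → ℤ} → Influence ℓ F → Influence m G →
    q ^ n * 𝔼 (λ y → F y * G y) - 𝔼 F * 𝔼 G ≤ q ^ n * q ^ n * ∑ (λ i → ℓ i * m i)
  covariance-bound {zero} {F = F} {G} _ _ = ≤-reflexive (id (F []) (G []))
    where
    id : ∀ x y → 1ℤ * (x * y) - x * y ≡ 0ℤ
    id = solve-∀
  covariance-bound {suc n} {ℓ} {m} {F} {G} (dF , lF) (dG , lG) =
    certify (id (q ^ n) (𝔼 (F ∘ (false ∷_))) (𝔼 (F ∘ (true ∷_))) (𝔼 (G ∘ (false ∷_))) (𝔼 (G ∘ (true ∷_))) _ _ (ℓ zero)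
        (m zero) _)
      (pos≥0 {2} ⊗ gap (covariance-bound (lF false) (lG false)) ⊕ pos≥0 {2} ⊗ gap
          (covariance-bound (lF true) (lG true)) ⊕ gap step)
    where
    step : (𝔼 (F ∘ (true ∷_)) - 𝔼 (F ∘ (false ∷_))) * (𝔼 (G ∘ (true ∷_)) - 𝔼 (G ∘ (false ∷_)))
      ≤ q ^ n * (+ 2 * ℓ zero) * (q ^ n * (+ 2 * m zero))
    step = Bounded-* (subst (Bounded _) (𝔼-- (F ∘ (true ∷_)) (F ∘ (false ∷_))) (𝔼-Bounded dF))
                     (subst (Bounded _) (𝔼-- (G ∘ (true ∷_)) (G ∘ (false ∷_))) (𝔼-Bounded dG))
    id : ∀ N f₀ f₁ g₀ g₁ e₀ e₁ l m S →
      (1ℤ + 1ℤ) * N * ((1ℤ + 1ℤ) * N) * (l * m + S)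
          - ((1ℤ + 1ℤ) * N * (1ℤ * e₀ + e₁) - (1ℤ * f₀ + f₁) * (1ℤ * g₀ + g₁))
      ≡ + 2 * (N * N * S - (N * e₀ - f₀ * g₀)) + + 2 * (N * N * S - (N * e₁ - f₁ * g₁))
        + (N * (+ 2 * l) * (N * (+ 2 * m)) - (f₁ - f₀) * (g₁ - g₀))
    id = solve-∀

  correlation-bound : ∀ {ℓ m} {F G : Vec Bool n → ℤ} → Influence ℓ F → Influence m G → 𝔼 F ≡ 0ℤ →
    𝔼 (λ y → F y * G y) ≤ q ^ n * ∑ (λ i → ℓ i * m i)
  correlation-bound {n} {ℓ} {m} {F} {G} iF iG F0 =
    cancel-pos (mass>0 n) (subst₂ _≤_
        (trans (cong (λ z → q ^ n * 𝔼 (λ y → F y * G y) - z * 𝔼 G) F0) (id (q ^ n * 𝔼 (λ y → F y * G y)) (𝔼 G)))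
        (*-assoc (q ^ n) (q ^ n) _) (covariance-bound iF iG))
    where
    id : ∀ a b → a - 0ℤ * b ≡ a
    id = solve-∀

  -- Both values of a coordinate have weight 1 here, so negating all coordinates preserves the
  -- expectation.
  𝔼-odd : (F : Vec Bool n → ℤ) → (∀ y → F (map not y) ≡ - F y) → 𝔼 F ≡ 0ℤ
  𝔼-odd {n} F odd = halve (𝔼 F) (trans
      (sym (trans (𝔼-cong odd) (trans (𝔼-cong λ y → sym (-1*i≡-i (F y))) (trans (𝔼-* -1ℤ F) (-1*i≡-i (𝔼 F))))))
      (flip F))
    where
    flip : ∀ {n} (F : Vec Bool n → ℤ) → 𝔼 (F ∘ map not) ≡ 𝔼 F
    flip {zero} F = refl
    flip {suc n} F = trans (cong₂ (λ a b → 1ℤ * a + b) (flip (F ∘ (true ∷_))) (flip (F ∘ (false ∷_))))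
        (id (𝔼 (F ∘ (true ∷_))) _)
      where
      id : ∀ a b → 1ℤ * a + b ≡ 1ℤ * b + a
      id = solve-∀
    halve : ∀ x → - x ≡ x → x ≡ 0ℤ
    halve (+ zero) _ = refl
    halve +[1+ n ] ()
    halve -[1+ n ] ()

-- Clipped sums of random signs

sgn : Bool → ℤ
sgn true = 1ℤ
sgn false = -1ℤ

signedSum : (Fin n → Bool) → Vec Bool n → ℤ
signedSum R y = ∑ λ i → ⟦ R i ⟧ * sgn (lookup y i)

size : (Fin n → Bool) → ℤ
size R = ∑ λ i → ⟦ R i ⟧

size≥0 : (R : Fin n → Bool) → 0ℤ ≤ size R
size≥0 R = ∑≥0 λ i → ⟦⟧≥0 (R i)

⟦⟧-idem : ∀ b → ⟦ b ⟧ * ⟦ b ⟧ ≡ ⟦ b ⟧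
⟦⟧-idem true = refl
⟦⟧-idem false = refl

clip : ℤ → ℤ → ℤ
clip M x = - M ⊔ (x ⊓ M)

module _ {M : ℤ} (M≥0 : 0ℤ ≤ M) where

  private
    -M≤M : - M ≤ M
    -M≤M = ≤-trans (neg-mono-≤ M≥0) M≥0

  clip-low : ∀ {x} → x ≤ - M → clip M x ≡ - M
  clip-low {x} p = i≥j⇒i⊔j≡i (≤-trans (i⊓j≤i x M) p)

  clip-mid : ∀ {x} → Bounded M x → clip M x ≡ x
  clip-mid {x} (p , q) = trans (cong (- M ⊔_) (i≤j⇒i⊓j≡i q)) (i≤j⇒i⊔j≡j p)

  clip-high : ∀ {x} → M ≤ x → clip M x ≡ M
  clip-high {x} p = trans (cong (- M ⊔_) (i≥j⇒i⊓j≡j p)) (i≤j⇒i⊔j≡j -M≤M)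

  clip-bounded : ∀ x → Bounded M (clip M x)
  clip-bounded x = i≤i⊔j (- M) _ , ⊔-lub -M≤M (i⊓j≤j x M)

  clip-cases : ∀ x → x ≤ - M ⊎ Bounded M x ⊎ M ≤ x
  clip-cases x with ≤-total x (- M) | ≤-total x M
  ... | inj₁ p | _ = inj₁ p
  ... | inj₂ p | inj₁ q = inj₂ (inj₁ (p , q))
  ... | inj₂ p | inj₂ q = inj₂ (inj₂ q)

  clip-neg : ∀ x → clip M (- x) ≡ - clip M x
  clip-neg x with clip-cases x
  ... | inj₁ p = trans (clip-high (subst (_≤ - x) (neg-involutive M) (neg-mono-≤ p)))
      (sym (trans (cong -_ (clip-low p)) (neg-involutive M)))
  ... | inj₂ (inj₁ (p , q)) = trans (clip-mid (neg-mono-≤ q , subst (- x ≤_) (neg-involutive M) (neg-mono-≤ p)))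
      (cong -_ (sym (clip-mid (p , q))))
  ... | inj₂ (inj₂ p) = trans (clip-low (neg-mono-≤ p)) (cong -_ (sym (clip-high p)))

  -- Clipping is monotone, and adding `δ` commutes with minimum and maximum, so `clip M x + δ` is a
  -- clipping of `x + δ` between bounds that are both raised.
  clip-increment : ∀ {δ} x → 0ℤ ≤ δ → Bounded δ (clip M (x + δ) - clip M x)
  clip-increment {δ} x δ≥0 =
    ≤-trans (neg-mono-≤ δ≥0) (gap (⊔-mono-≤ (≤-refl { - M}) (⊓-mono-≤ x≤x+δ (≤-refl {M})))) ,
    certify (id δ (clip M (x + δ)) (clip M x))
        (gap (≤-trans (⊔-mono-≤ (shift (- M)) (⊓-mono-≤ ≤-refl (shift M))) (≤-reflexive (sym distribute))))
    where
    shift : ∀ y → y ≤ y + δ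
    shift y = subst (_≤ y + δ) (+-identityʳ y) (+-monoʳ-≤ y δ≥0)
    x≤x+δ = shift x
    distribute : clip M x + δ ≡ (- M + δ) ⊔ ((x + δ) ⊓ (M + δ))
    distribute = trans (mono-≤-distrib-⊔ (+-monoˡ-≤ δ) (- M) (x ⊓ M))
        (cong ((- M + δ) ⊔_) (mono-≤-distrib-⊓ (+-monoˡ-≤ δ) x M))
    id : ∀ d a b → d - (a - b) ≡ b + d - a
    id = solve-∀

  -- Outside [- M , M] the left-hand side is nonpositive.
  clip-quartic : ∀ x → M * M * (x * x) - x * x * (x * x) ≤ M * M * (x * clip M x)
  clip-quartic x with clip-cases x
  ... | inj₁ p rewrite clip-low p = certify (id M x) (M≥0 ⊗ M≥0 ⊗ (M≥0 ⊗ -x≥0) ⊕ sq≥0 x ⊗ ((-x≥0 ⊕ M≥0) ⊗ gap p))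
    where
    -x≥0 : 0ℤ ≤ - x
    -x≥0 = ≤-trans M≥0 (subst (_≤ - x) (neg-involutive M) (neg-mono-≤ p))
    id : ∀ M x → M * M * (x * - M) - (M * M * (x * x) - x * x * (x * x)) ≡
        M * M * (M * - x) + x * x * ((- x + M) * (- M - x))
    id = solve-∀
  ... | inj₂ (inj₁ p) rewrite clip-mid p = certify (id M x) (sq≥0 (x * x))
    where
    id : ∀ M x → M * M * (x * x) - (M * M * (x * x) - x * x * (x * x)) ≡ x * x * (x * x)
    id = solve-∀
  ... | inj₂ (inj₂ p) rewrite clip-high p = certify (id M x)
      (M≥0 ⊗ M≥0 ⊗ (M≥0 ⊗ x≥0) ⊕ sq≥0 x ⊗ ((x≥0 ⊕ M≥0) ⊗ gap p))
    where
    x≥0 : 0ℤ ≤ x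
    x≥0 = ≤-trans M≥0 p
    id : ∀ M x → M * M * (x * M) - (M * M * (x * x) - x * x * (x * x)) ≡ M * M * (M * x) + x * x * ((x + M) * (x - M))
    id = solve-∀

sgn-not : ∀ b → sgn (not b) ≡ - sgn b
sgn-not true = refl
sgn-not false = refl

∑-neg : (f : Fin n → ℤ) → ∑ (λ i → - f i) ≡ - ∑ f
∑-neg f = trans (sum-cong-≗ λ i → sym (-1*i≡-i (f i))) (trans (∑-*ˡ -1ℤ f) (-1*i≡-i (∑ f)))

signedSum-not : (R : Fin n → Bool) (y : Vec Bool n) → signedSum R (map not y) ≡ - signedSum R y
signedSum-not R y = trans (sum-cong-≗ λ i → trans (cong (λ b → ⟦ R i ⟧ * sgn b) (lookup-map i not y))
    (trans (cong (⟦ R i ⟧ *_) (sgn-not (lookup y i))) (sym (neg-distribʳ-* ⟦ R i ⟧ (sgn (lookup y i))))))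
    (∑-neg λ i → ⟦ R i ⟧ * sgn (lookup y i))

module _ where
  open Expectation 1ℤ pos≥0

  private
    𝔼-suc : (f : Vec Bool (suc n) → ℤ) → 𝔼 f ≡ 𝔼 (λ y → f (false ∷ y) + f (true ∷ y))
    𝔼-suc f = trans (cong (_+ 𝔼 (f ∘ (true ∷_))) (*-identityˡ (𝔼 (f ∘ (false ∷_)))))
        (sym (𝔼-+ (f ∘ (false ∷_)) (f ∘ (true ∷_))))

  second-moment : (R : Fin n → Bool) → 𝔼 (λ y → signedSum R y * signedSum R y) ≡ q ^ n * size R
  second-moment {zero} R = refl
  second-moment {suc n} R =
    trans (𝔼-suc (λ y → signedSum R y * signedSum R y)) (trans (𝔼-cong λ y → id₁ ⟦ R zero ⟧ (S y))
      (trans (𝔼-+ (λ y → + 2 * (S y * S y)) (λ _ → + 2 * (⟦ R zero ⟧ * ⟦ R zero ⟧)))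
        (trans (cong₂ _+_ (trans (𝔼-* (+ 2) λ y → S y * S y) (cong (+ 2 *_) (second-moment (R ∘ suc))))
            (trans (𝔼-const n _) (cong (λ t → q ^ n * (+ 2 * t)) (⟦⟧-idem (R zero)))))
          (id₂ (q ^ n) ⟦ R zero ⟧ (size (R ∘ suc))))))
    where
    S = signedSum (R ∘ suc)
    id₁ : ∀ r s → (r * -1ℤ + s) * (r * -1ℤ + s) + (r * 1ℤ + s) * (r * 1ℤ + s) ≡ + 2 * (s * s) + + 2 * (r * r)
    id₁ = solve-∀
    id₂ : ∀ m r k → + 2 * (m * k) + m * (+ 2 * r) ≡ (1ℤ + 1ℤ) * m * (r + k)
    id₂ = solve-∀

  -- The Khintchine inequality for exponent 4. Averaging over one more sign kills the odd powers,
  -- and the slack left over is nonnegative because an indicator is 0 or 1.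
  fourth-moment : (R : Fin n → Bool) → let S = signedSum R in
    𝔼 (λ y → S y * S y * (S y * S y)) ≤ + 3 * (q ^ n * (size R * size R))
  fourth-moment {zero} R = ≤-refl
  fourth-moment {suc n} R = subst (_≤ + 3 * (q ^ suc n * (size R * size R))) (sym expand)
      (certify (id₂ (q ^ n) ⟦ R zero ⟧ (size (R ∘ suc)) _)
    (pos≥0 {2} ⊗ gap (fourth-moment (R ∘ suc)) ⊕ pos≥0 {2} ⊗ (<⇒≤ (mass>0 n) ⊗ sum≥0 (R zero))))
    where
    S = signedSum (R ∘ suc)
    sum≥0 : ∀ b → 0ℤ ≤ + 3 * (⟦ b ⟧ * ⟦ b ⟧) - ⟦ b ⟧ * ⟦ b ⟧ * (⟦ b ⟧ * ⟦ b ⟧) + + 6 * ((⟦ b ⟧ - ⟦ b ⟧ * ⟦ b ⟧) * size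
        (R ∘ suc))
    sum≥0 true = pos≥0
    sum≥0 false = pos≥0
    id₁ : ∀ r s → (r * -1ℤ + s) * (r * -1ℤ + s) * ((r * -1ℤ + s) * (r * -1ℤ + s)) + (r * 1ℤ + s) * (r * 1ℤ + s)
        * ((r * 1ℤ + s) * (r * 1ℤ + s))
      ≡ + 2 * (s * s * (s * s)) + + 12 * (r * r) * (s * s) + + 2 * (r * r * (r * r))
    id₁ = solve-∀
    expand : 𝔼 (λ y → signedSum R y * signedSum R y * (signedSum R y * signedSum R y))
      ≡ + 2 * 𝔼 (λ y → S y * S y * (S y * S y)) + + 12 * (⟦ R zero ⟧ * ⟦ R zero ⟧) * (q ^ n * size (R ∘ suc)) + q ^ n
          * (+ 2 * (⟦ R zero ⟧ * ⟦ R zero ⟧ * (⟦ R zero ⟧ * ⟦ R zero ⟧)))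
    expand = trans (𝔼-suc (λ y → signedSum R y * signedSum R y * (signedSum R y * signedSum R y)))
        (trans (𝔼-cong λ y → id₁ ⟦ R zero ⟧ (S y))
      (trans (𝔼-+ (λ y → + 2 * (S y * S y * (S y * S y)) + + 12 * (⟦ R zero ⟧ * ⟦ R zero ⟧) * (S y * S y))
          (λ _ → + 2 * (⟦ R zero ⟧ * ⟦ R zero ⟧ * (⟦ R zero ⟧ * ⟦ R zero ⟧)))) (cong₂ _+_
        (trans (𝔼-+ (λ y → + 2 * (S y * S y * (S y * S y))) (λ y → + 12 * (⟦ R zero ⟧ * ⟦ R zero ⟧) * (S y * S y)))
          (cong₂ _+_ (𝔼-* (+ 2) λ y → S y * S y * (S y * S y))
              (trans (𝔼-* (+ 12 * (⟦ R zero ⟧ * ⟦ R zero ⟧)) λ y → S y * S y)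
              (cong (+ 12 * (⟦ R zero ⟧ * ⟦ R zero ⟧) *_) (second-moment (R ∘ suc))))))
        (𝔼-const n _))))
    id₂ : ∀ m r k e → + 3 * ((1ℤ + 1ℤ) * m * ((r + k) * (r + k)))
        - (+ 2 * e + + 12 * (r * r) * (m * k) + m * (+ 2 * (r * r * (r * r))))
      ≡ + 2 * (+ 3 * (m * (k * k)) - e) + + 2 * (m * (+ 3 * (r * r) - r * r * (r * r) + + 6 * ((r - r * r) * k)))
    id₂ = solve-∀

  -- By `clip-quartic` the mean of `S * clip M S` times `M * M` is at least `M * M` times the second
  -- moment minus the fourth. With `k = size R` these moments are `k` and at most `3 k * k`, and
  -- `4 k ≤ M * M` leaves a quarter of the second moment.
  gain : ∀ {M} (R : Fin n → Bool) → 0ℤ < M → + 4 * size R ≤ M * M →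
    q ^ n * size R ≤ + 4 * 𝔼 (λ y → signedSum R y * clip M (signedSum R y))
  gain {n} {M} R M>0 k≤M² = cancel-pos M²>0 (certify (id M (q ^ n) (size R) _ _)
      (pos≥0 {4} ⊗ gap bound ⊕ pos≥0 {4} ⊗ gap (fourth-moment R) ⊕ pos≥0 {3} ⊗
          (<⇒≤ (mass>0 n) ⊗ (size≥0 R ⊗ gap k≤M²))))
    where
    S = signedSum R
    M²>0 : 0ℤ < M * M
    M²>0 = subst (_< M * M) (*-zeroʳ M) (*-monoˡ-<-pos M {{positive M>0}} M>0)
    expand : 𝔼 (λ y → M * M * (S y * S y) - S y * S y * (S y * S y)) ≡ M * M * (q ^ n * size R) - 𝔼
        (λ y → S y * S y * (S y * S y))
    expand = trans (𝔼-+ (λ y → M * M * (S y * S y)) (λ y → - (S y * S y * (S y * S y))))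
      (cong₂ _+_ (trans (𝔼-* (M * M) (λ y → S y * S y)) (cong (M * M *_) (second-moment R)))
        (trans (𝔼-cong λ y → sym (-1*i≡-i (S y * S y * (S y * S y))))
            (trans (𝔼-* -1ℤ λ y → S y * S y * (S y * S y)) (-1*i≡-i _))))
    bound : M * M * (q ^ n * size R) - 𝔼 (λ y → S y * S y * (S y * S y)) ≤ M * M * 𝔼 (λ y → S y * clip M (S y))
    bound = subst₂ _≤_ expand (𝔼-* (M * M) (λ y → S y * clip M (S y))) (𝔼-mono λ y → clip-quartic (<⇒≤ M>0) (S y))
    id : ∀ M m k f g → M * M * (+ 4 * g) - M * M * (m * k)
      ≡ + 4 * (M * M * g - (M * M * (m * k) - f)) + + 4 * (+ 3 * (m * (k * k)) - f) + + 3
          * (m * (k * (M * M - + 4 * k)))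
    id = solve-∀

-- Influences of signs and of clipped sums

Influence-cong : ∀ {ℓ} {F G : Vec Bool n → ℤ} → (∀ y → F y ≡ G y) → Influence ℓ F → Influence ℓ G
Influence-cong {zero} h _ = tt
Influence-cong {suc n} h (d , l) = (λ y → subst (Bounded _) (cong₂ _-_ (h (true ∷ y)) (h (false ∷ y))) (d y)) , λ b →
    Influence-cong (h ∘ (b ∷_)) (l b)

Influence-const : ∀ {ℓ : Fin n → ℤ} → (∀ i → 0ℤ ≤ ℓ i) → ∀ c → Influence ℓ (λ _ → c)
Influence-const {zero} h c = tt
Influence-const {suc n} {ℓ} h c = (λ _ → subst (Bounded (+ 2 * ℓ zero)) (sym (+-inverseʳ c)) (neg-mono-≤ 2ℓ≥0 , 2ℓ≥0))
    , λ _ → Influence-const (h ∘ suc) c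
  where
  2ℓ≥0 = pos≥0 {2} ⊗ h zero

Influence-neg : ∀ {ℓ} {F : Vec Bool n → ℤ} → Influence ℓ F → Influence ℓ (λ y → - F y)
Influence-neg {zero} _ = tt
Influence-neg {suc n} {ℓ} {F} (d , l) =
  (λ y → subst (Bounded _) (id (F (true ∷ y)) (F (false ∷ y)))
    (neg-mono-≤ (proj₂ (d y)) , subst (- (F (true ∷ y) - F (false ∷ y)) ≤_) (neg-involutive (+ 2 * ℓ zero))
        (neg-mono-≤ (proj₁ (d y))))) ,
  λ b → Influence-neg (l b)
  where
  id : ∀ a b → - (a - b) ≡ - a - - b
  id = solve-∀

single : Fin n → Fin n → Bool
single i j = does (i Fin.≟ j)

Influence-sgn : ∀ {M} → 0ℤ ≤ M → (w : Fin n) → Influence (λ i → M * ⟦ single w i ⟧) (λ y → M * sgn (lookup y w))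
Influence-sgn {M = M} M≥0 zero =
    (λ _ → subst (Bounded (+ 2 * (M * 1ℤ))) (id M) (≤-trans (neg-mono-≤ 2M≥0) 2M≥0 , ≤-refl)) , λ b → Influence-const
    (λ i → M≥0 ⊗ pos≥0) (M * sgn b)
  where
  2M≥0 : 0ℤ ≤ + 2 * (M * 1ℤ)
  2M≥0 = pos≥0 {2} ⊗ (M≥0 ⊗ pos≥0 {1})
  id : ∀ M → + 2 * (M * 1ℤ) ≡ M * 1ℤ - M * -1ℤ
  id = solve-∀
Influence-sgn {M = M} M≥0 (suc w) = (λ y → subst (Bounded (+ 2 * (M * 0ℤ))) (sym (+-inverseʳ (M * sgn (lookup y w))))
    (≤-reflexive (id M) , ≤-reflexive (id′ M))) , λ _ → Influence-sgn M≥0 w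
  where
  id : ∀ M → - (+ 2 * (M * 0ℤ)) ≡ 0ℤ
  id = solve-∀
  id′ : ∀ M → 0ℤ ≡ + 2 * (M * 0ℤ)
  id′ = solve-∀

-- The offset `c` collects the signs of the coordinates already fixed. Flipping a sign moves the sum
-- by 2 and clipping does not expand distances.
Influence-clip : ∀ {M} → 0ℤ ≤ M → (R : Fin n → Bool) (c : ℤ) → Influence (λ i → ⟦ R i ⟧)
    (λ y → clip M (c + signedSum R y))
Influence-clip {zero} M≥0 R c = tt
Influence-clip {suc n} {M} M≥0 R c =
  (λ y → subst (λ x → Bounded (+ 2 * r) (clip M x - clip M (c + (r * -1ℤ + S y)))) (id c r (S y))
      (clip-increment M≥0 (c + (r * -1ℤ + S y)) (pos≥0 {2} ⊗ ⟦⟧≥0 (R zero)))) ,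
  λ b → Influence-cong (λ y → cong (clip M) (+-assoc c (r * sgn b) (S y)))
      (Influence-clip M≥0 (R ∘ suc) (c + r * sgn b))
  where
  r = ⟦ R zero ⟧
  S = signedSum (R ∘ suc)
  id : ∀ c r s → c + (r * -1ℤ + s) + + 2 * r ≡ c + (r * 1ℤ + s)
  id = solve-∀

-- Quadratic forms and the opposing strategy

Relation : ℕ → Set
Relation n = Fin n → Fin n → Bool

form : Relation n → (Fin n → ℤ) → (Fin n → ℤ) → ℤ
form B x y = ∑ λ u → ∑ λ v → ⟦ B u v ⟧ * (x u * y v)

Asymmetric : Relation n → Set
Asymmetric B = ∀ u v → B u v ≡ true → B v u ≡ false

single-distinct : {u v : Fin n} → u ≢ v → ∀ i → ⟦ single u i ⟧ * ⟦ single v i ⟧ ≡ 0ℤ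
single-distinct {u = u} {v} u≢v i with u Fin.≟ i | v Fin.≟ i
... | yes refl | yes refl = ⊥-elim (u≢v refl)
... | yes _ | no _ = refl
... | no _ | yes _ = refl
... | no _ | no _ = refl

single-outside : (R : Fin n → Bool) {u : Fin n} → R u ≡ false → ∀ i → ⟦ single u i ⟧ * ⟦ R i ⟧ ≡ 0ℤ
single-outside R {u} Ru i with u Fin.≟ i
... | yes refl rewrite Ru = refl
... | no _ = refl

loopless : {B : Relation n} → Asymmetric B → ∀ {u v} → B u v ≡ true → u ≢ v
loopless {B = B} asym {u} Buv refl with trans (sym Buv) (asym u u Buv)
... | ()

∑∑-distrib-+ : ∀ {m} (f g : Fin m → Fin n → ℤ) → (∑ λ u → ∑ λ v → f u v + g u v) ≡
    (∑ λ u → ∑ λ v → f u v) + (∑ λ u → ∑ λ v → g u v)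
∑∑-distrib-+ f g = trans (sum-cong-≗ λ u → ∑-distrib-+ (f u) (g u)) (∑-distrib-+ (λ u → ∑ (f u)) (λ u → ∑ (g u)))

∑∑-*ˡ : ∀ {m} c (f : Fin m → Fin n → ℤ) → (∑ λ u → ∑ λ v → c * f u v) ≡ c * (∑ λ u → ∑ λ v → f u v)
∑∑-*ˡ c f = trans (sum-cong-≗ λ u → ∑-*ˡ c (f u)) (∑-*ˡ c λ u → ∑ (f u))

-- Sources (the vertices in Q) take random signs and every other vertex v opposes the clipped sum of the signs
-- of its sources R _ v.
module Opposing {B : Relation n} (asym : Asymmetric B) (Q : Fin n → Bool) (R : Relation n) (M : ℤ) (M>0 : 0ℤ < M)
  (R⊆B : ∀ {w v} → R w v ≡ true → B w v ≡ true) (R-source : ∀ {w v} → R w v ≡ true → Q w ≡ true)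
      (R-target : ∀ {w v} → R w v ≡ true → Q v ≡ false)
  (small : ∀ v → + 4 * size (λ w → R w v) ≤ M * M) where

  open Expectation 1ℤ pos≥0

  private
    M≥0 = <⇒≤ M>0

    S G : Fin n → Vec Bool n → ℤ
    S v = signedSum (λ w → R w v)
    G v y = clip M (S v y)

  opinion : Fin n → Vec Bool n → ℤ
  opinion v y = if Q v then M * sgn (lookup y v) else - G v y

  overlaps : ℤ
  overlaps = ∑ λ u → ∑ λ v → ⟦ B u v ⟧ * ∑ λ i → ⟦ R i u ⟧ * ⟦ R i v ⟧

  opinion-bounded : ∀ v y → Bounded M (opinion v y)
  opinion-bounded v y with Q v | lookup y v
  ... | true | true = ≤-trans (neg-mono-≤ M≥0) (M≥0 ⊗ pos≥0 {1}) , ≤-reflexive (*-identityʳ M)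
  ... | true | false = ≤-reflexive (id M) , ≤-trans (≤-reflexive (sym (id M))) (≤-trans (neg-mono-≤ M≥0) M≥0)
    where
    id : ∀ M → - M ≡ M * -1ℤ
    id = solve-∀
  ... | false | _ = neg-mono-≤ (proj₂ b) , subst (- G v y ≤_) (neg-involutive M) (neg-mono-≤ (proj₁ b))
    where
    b = clip-bounded M≥0 (S v y)

  private
    -- A source depends on its own sign alone, with full strength `M`; a target depends on each of
    -- its sources with strength only 1. This asymmetry is what makes gains outweigh losses.
    influence : Fin n → Fin n → ℤ
    influence v i = if Q v then M * ⟦ single v i ⟧ else ⟦ R i v ⟧

    opinion-influence : ∀ v → Influence (influence v) (opinion v)
    opinion-influence v with Q v
    ... | true = Influence-sgn M≥0 v
    ... | false = Influence-neg (Influence-cong (λ y → cong (clip M) (+-identityˡ (S v y)))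
        (Influence-clip M≥0 (λ w → R w v) 0ℤ))

    opinion-odd : ∀ v y → opinion v (map not y) ≡ - opinion v y
    opinion-odd v y with Q v
    ... | true = trans (cong (M *_) (trans (cong sgn (lookup-map v not y)) (sgn-not (lookup y v))))
        (sym (neg-distribʳ-* M _))
    ... | false = cong -_ (trans (cong (clip M) (signedSum-not (λ w → R w v) y)) (clip-neg M≥0 (S v y)))

    overlap≥0 : ∀ u v → 0ℤ ≤ ∑ λ i → ⟦ R i u ⟧ * ⟦ R i v ⟧
    overlap≥0 u v = ∑≥0 λ i → ⟦⟧≥0 (R i u) ⊗ ⟦⟧≥0 (R i v)

    -- Two distinct sources share no coordinate. A source and a target share one only along an edge
    -- of `R`: in one direction this is excluded by hypothesis, in the other by asymmetry of `B`.
    -- Only pairs of targets can lose.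
    influence-overlap : ∀ {u v} → B u v ≡ true → R u v ≡ false → ∀ i → influence u i * influence v i ≤
        ⟦ R i u ⟧ * ⟦ R i v ⟧
    influence-overlap {u} {v} Buv ¬Ruv i with Q u | Q v | ⟦⟧≥0 (R i u) ⊗ ⟦⟧≥0 (R i v)
    ... | true | true | p = subst (_≤ _)
        (sym (trans (id M ⟦ single u i ⟧ ⟦ single v i ⟧)
        (trans (cong (M * M *_) (single-distinct (loopless asym Buv) i)) (*-zeroʳ (M * M))))) p
      where
      id : ∀ M a b → M * a * (M * b) ≡ M * M * (a * b)
      id = solve-∀
    ... | true | false | p = subst (_≤ _)
        (sym (trans (*-assoc M _ _) (trans (cong (M *_) (single-outside (λ w → R w v) ¬Ruv i)) (*-zeroʳ M)))) p
    ... | false | true | p = subst (_≤ _)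
        (sym (trans (id M ⟦ R i u ⟧ ⟦ single v i ⟧)
        (trans (cong (M *_) (single-outside (λ w → R w u) ¬Rvu i)) (*-zeroʳ M)))) p
      where
      id : ∀ M a b → a * (M * b) ≡ M * (b * a)
      id = solve-∀
      ¬Rvu : R v u ≡ false
      ¬Rvu with R v u in eq
      ... | false = refl
      ... | true with trans (sym (R⊆B eq)) (asym u v Buv)
      ...   | ()
    ... | false | false | p = ≤-refl

    -- On an edge of `R` the source's sign factors out exactly. Elsewhere opinions are odd, hence of
    -- mean zero, and their correlation is controlled by common influences.
    pair-bound : ∀ {u v} → B u v ≡ true →
      𝔼 (λ y → opinion u y * opinion v y) ≤ - M * (⟦ R u v ⟧ * 𝔼 (λ y → sgn (lookup y u) * G v y)) + q ^ n * ∑ λ i →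
          ⟦ R i u ⟧ * ⟦ R i v ⟧
    pair-bound {u} {v} Buv with R u v in eq
    ... | false = subst (𝔼 (λ y → opinion u y * opinion v y) ≤_) (id M (𝔼 λ y → sgn (lookup y u) * G v y) _)
        (≤-trans (correlation-bound (opinion-influence u) (opinion-influence v) (𝔼-odd (opinion u) (opinion-odd u)))
          (scale (<⇒≤ (mass>0 n)) (∑-mono (influence-overlap Buv eq))))
      where
      id : ∀ M e z → z ≡ - M * (0ℤ * e) + z
      id = solve-∀
    ... | true = certify (id M (𝔼 λ y → sgn (lookup y u) * G v y) _ _ exact) (<⇒≤ (mass>0 n) ⊗ overlap≥0 u v)
      where
      exact : 𝔼 (λ y → opinion u y * opinion v y) ≡ - M * 𝔼 (λ y → sgn (lookup y u) * G v y)
      exact = trans (𝔼-cong pointwise) (𝔼-* (- M) λ y → sgn (lookup y u) * G v y)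
        where
        id′ : ∀ M s g → M * s * - g ≡ - M * (s * g)
        id′ = solve-∀
        pointwise : ∀ y → opinion u y * opinion v y ≡ - M * (sgn (lookup y u) * G v y)
        pointwise y rewrite R-source eq | R-target eq = id′ M (sgn (lookup y u)) (G v y)
      id″ : ∀ M e z → - M * (1ℤ * e) + z - - M * e ≡ z
      id″ = solve-∀
      id : ∀ M e z x → x ≡ - M * e → - M * (1ℤ * e) + z - x ≡ z
      id M e z x refl = id″ M e z

    𝔼-form : 𝔼 (λ y → form B (λ u → opinion u y) (λ v → opinion v y)) ≡ ∑ λ u → ∑ λ v → ⟦ B u v ⟧ * 𝔼
        (λ y → opinion u y * opinion v y)
    𝔼-form = trans (𝔼-∑ λ u y → ∑ λ v → ⟦ B u v ⟧ * (opinion u y * opinion v y)) (sum-cong-≗ λ u →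
      trans (𝔼-∑ λ v y → ⟦ B u v ⟧ * (opinion u y * opinion v y))
          (sum-cong-≗ λ v → 𝔼-* ⟦ B u v ⟧ λ y → opinion u y * opinion v y))

    term-bound : ∀ u v → ⟦ B u v ⟧ * 𝔼 (λ y → opinion u y * opinion v y) ≤
      - M * (⟦ R u v ⟧ * 𝔼 (λ y → sgn (lookup y u) * G v y)) + q ^ n * (⟦ B u v ⟧ * ∑ λ i → ⟦ R i u ⟧ * ⟦ R i v ⟧)
    term-bound u v with B u v in eq
    ... | true = subst₂ _≤_ (sym (*-identityˡ (𝔼 λ y → opinion u y * opinion v y)))
        (+-congˡ (- M * (⟦ R u v ⟧ * 𝔼 (λ y → sgn (lookup y u) * G v y)))
        (cong (q ^ n *_) (sym (*-identityˡ (∑ λ i → ⟦ R i u ⟧ * ⟦ R i v ⟧))))) (pair-bound eq)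
    ... | false with R u v in eq′
    ...   | false = ≤-reflexive (id M (q ^ n) (𝔼 (λ y → sgn (lookup y u) * G v y)) (∑ λ i → ⟦ R i u ⟧ * ⟦ R i v ⟧))
      where
      id : ∀ M m e z → 0ℤ ≡ - M * (0ℤ * e) + m * (0ℤ * z)
      id = solve-∀
    ...   | true with trans (sym eq) (R⊆B eq′)
    ...     | ()

    -- Grouping the edges of `R` by their target assembles the signs of its sources into `S v`, the
    -- sum whose clipping it opposes.
    collect : ∑ (λ u → ∑ λ v → ⟦ R u v ⟧ * 𝔼 (λ y → sgn (lookup y u) * G v y)) ≡ ∑ λ v → 𝔼 (λ y → S v y * G v y)
    collect = trans (∑-comm λ u v → ⟦ R u v ⟧ * 𝔼 (λ y → sgn (lookup y u) * G v y)) (sum-cong-≗ λ v → sym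
      (trans (𝔼-cong λ y → trans (*-distribʳ-sum (G v y) (λ u → ⟦ R u v ⟧ * sgn (lookup y u)))
          (sum-cong-≗ λ u → *-assoc ⟦ R u v ⟧ (sgn (lookup y u)) (G v y)))
        (trans (𝔼-∑ λ u y → ⟦ R u v ⟧ * (sgn (lookup y u) * G v y))
            (sum-cong-≗ λ u → 𝔼-* ⟦ R u v ⟧ λ y → sgn (lookup y u) * G v y))))

  opposing-form : ∃ λ y → M * (∑ λ v → size λ w → R w v) - + 4 * overlaps ≤ - + 4 * form B (λ u → opinion u y)
      (λ v → opinion v y)
  opposing-form = 𝔼-attained (λ y → - + 4 * form B (λ u → opinion u y) (λ v → opinion v y))
      (subst (q ^ n * (M * K - + 4 * overlaps) ≤_) (sym expand)
      (certify (id M (q ^ n) K overlaps g f) (pos≥0 {4} ⊗ gap total ⊕ M≥0 ⊗ gap gains)))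
    where
    K = ∑ λ v → size λ w → R w v
    g = ∑ λ v → 𝔼 (λ y → S v y * G v y)
    f = ∑ λ u → ∑ λ v → ⟦ B u v ⟧ * 𝔼 (λ y → opinion u y * opinion v y)
    expand : 𝔼 (λ y → - + 4 * form B (λ u → opinion u y) (λ v → opinion v y)) ≡ - + 4 * f
    expand = trans (𝔼-* (- + 4) λ y → form B (λ u → opinion u y) (λ v → opinion v y)) (cong (- + 4 *_) 𝔼-form)
    total : f ≤ - M * g + q ^ n * overlaps
    total = ≤-trans (∑-mono λ u → ∑-mono (term-bound u)) (≤-reflexive
      (trans (∑∑-distrib-+ (λ u v → - M * (⟦ R u v ⟧ * 𝔼 (λ y → sgn (lookup y u) * G v y)))
          (λ u v → q ^ n * (⟦ B u v ⟧ * ∑ λ i → ⟦ R i u ⟧ * ⟦ R i v ⟧)))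
        (cong₂ _+_ (trans (∑∑-*ˡ (- M) (λ u v → ⟦ R u v ⟧ * 𝔼 (λ y → sgn (lookup y u) * G v y)))
            (cong (- M *_) collect))
          (∑∑-*ˡ (q ^ n) (λ u v → ⟦ B u v ⟧ * ∑ λ i → ⟦ R i u ⟧ * ⟦ R i v ⟧)))))
    gains : q ^ n * K ≤ + 4 * g
    gains = subst₂ _≤_ (∑-*ˡ (q ^ n) λ v → size λ w → R w v) (∑-*ˡ (+ 4) λ v → 𝔼 (λ y → S v y * G v y))
        (∑-mono λ v → gain (λ w → R w v) M>0 (small v))
    id : ∀ M m K o g f → - + 4 * f - m * (M * K - + 4 * o) ≡ + 4 * (- M * g + m * o - f) + M * (+ 4 * g - m * K)
    id = solve-∀

-- Superposing and rounding vectors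

form-parallelogram : (B : Relation n) (x z : Fin n → ℤ) →
  form B (λ u → x u + z u) (λ u → x u + z u) + form B (λ u → x u - z u) (λ u → x u - z u) ≡
      + 2 * (form B x x + form B z z)
form-parallelogram B x z =
  trans (sym (∑∑-distrib-+ (λ u v → ⟦ B u v ⟧ * ((x u + z u) * (x v + z v)))
      (λ u v → ⟦ B u v ⟧ * ((x u - z u) * (x v - z v)))))
    (trans (sum-cong-≗ λ u → sum-cong-≗ λ v → id ⟦ B u v ⟧ (x u) (x v) (z u) (z v))
      (trans (∑∑-*ˡ (+ 2) (λ u v → ⟦ B u v ⟧ * (x u * x v) + ⟦ B u v ⟧ * (z u * z v)))
        (cong (+ 2 *_) (∑∑-distrib-+ (λ u v → ⟦ B u v ⟧ * (x u * x v)) (λ u v → ⟦ B u v ⟧ * (z u * z v))))))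
  where
  id : ∀ b x x′ z z′ → b * ((x + z) * (x′ + z′)) + b * ((x - z) * (x′ - z′)) ≡ + 2 * (b * (x * x′) + b * (z * z′))
  id = solve-∀

form-shift : (B : Relation n) (x e : Fin n → ℤ) (t : ℤ) →
  form B (λ u → x u + t * e u) (λ u → x u + t * e u) ≡ form B x x + t * (form B x e + form B e x) + t * t * form B e e
form-shift B x e t =
  trans (sum-cong-≗ λ u → sum-cong-≗ λ v → id ⟦ B u v ⟧ t (x u) (x v) (e u) (e v))
    (trans (∑∑-distrib-+ (λ u v → ⟦ B u v ⟧ * (x u * x v) + t * (⟦ B u v ⟧ * (x u * e v) + ⟦ B u v ⟧ * (e u * x v)))
        (λ u v → t * t * (⟦ B u v ⟧ * (e u * e v))))
      (cong₂ _+_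
        (trans (∑∑-distrib-+ (λ u v → ⟦ B u v ⟧ * (x u * x v))
            (λ u v → t * (⟦ B u v ⟧ * (x u * e v) + ⟦ B u v ⟧ * (e u * x v))))
          (+-congˡ (form B x x) (trans (∑∑-*ˡ t (λ u v → ⟦ B u v ⟧ * (x u * e v) + ⟦ B u v ⟧ * (e u * x v)))
            (cong (t *_) (∑∑-distrib-+ (λ u v → ⟦ B u v ⟧ * (x u * e v)) (λ u v → ⟦ B u v ⟧ * (e u * x v)))))))
        (∑∑-*ˡ (t * t) (λ u v → ⟦ B u v ⟧ * (e u * e v)))))
  where
  id : ∀ b t x x′ e e′ → b * ((x + t * e) * (x′ + t * e′)) ≡
      b * (x * x′) + t * (b * (x * e′) + b * (e * x′)) + t * t * (b * (e * e′))
  id = solve-∀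

Bounded-neg : ∀ {c x} → Bounded c x → Bounded c (- x)
Bounded-neg {c} {x} (p , q) = neg-mono-≤ q , subst (- x ≤_) (neg-involutive c) (neg-mono-≤ p)

Bounded-+ : ∀ {c d x y} → Bounded c x → Bounded d y → Bounded (c + d) (x + y)
Bounded-+ {c} {d} (p , q) (r , s) = subst (_≤ _) (sym (neg-distrib-+ c d)) (+-mono-≤ p r) , +-mono-≤ q s

-- By the parallelogram law one of x + z, x - z is at least as good as x and z together.
superpose : ∀ (B : Relation n) k (c Z : Fin k → Fin n → ℤ) → (∀ w u → Bounded (c w u) (Z w u)) →
  ∃ λ X → (∀ u → Bounded (∑ λ w → c w u) (X u)) × form B X X ≤ ∑ λ w → form B (Z w) (Z w)
superpose B zero c Z _ = (λ _ → 0ℤ) , (λ _ → ≤-refl , ≤-refl) , ≤-reflexive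
    (∑-zero λ u → ∑-zero λ v → *-zeroʳ ⟦ B u v ⟧)
superpose {n} B (suc k) c Z bounded with superpose B k (c ∘ suc) (Z ∘ suc) (bounded ∘ suc)
... | X , X-bounded , X-form = choose (≤-total (form B X₊ X₊) (form B X X + form B z z))
  where
  z X₊ X₋ : Fin n → ℤ
  z = Z zero
  X₊ u = X u + z u
  X₋ u = X u - z u
  Goal = ∃ λ X → (∀ u → Bounded (∑ λ w → c w u) (X u)) × form B X X ≤ ∑ λ w → form B (Z w) (Z w)
  rest : form B X X + form B z z ≤ ∑ λ w → form B (Z w) (Z w)
  rest = subst (_≤ ∑ λ w → form B (Z w) (Z w)) (+-comm (form B z z) (form B X X)) (+-monoʳ-≤ (form B z z) X-form)
  bound : ∀ {x} u → Bounded (c zero u) x → Bounded (∑ λ w → c w u) (X u + x)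
  bound {x} u b = subst (Bounded (∑ λ w → c w u)) (+-comm x (X u)) (Bounded-+ b (X-bounded u))
  id : ∀ p m s → s - m ≡ p - s + (+ 2 * s - (p + m))
  id = solve-∀
  choose : form B X₊ X₊ ≤ form B X X + form B z z ⊎ form B X X + form B z z ≤ form B X₊ X₊ → Goal
  choose (inj₁ p) = X₊ , (λ u → bound u (bounded zero u)) , ≤-trans p rest
  choose (inj₂ p) = X₋ , (λ u → bound u (Bounded-neg (bounded zero u))) ,
    ≤-trans (certify (id (form B X₊ X₊) (form B X₋ X₋) (form B X X + form B z z))
        (gap p ⊕ gap (≤-reflexive (form-parallelogram B X z)))) rest

Extreme : ℤ → ℤ → Set
Extreme M x = ∃ λ b → x ≡ M * sgn b

module Rounding {B : Relation n} (asym : Asymmetric B) {M : ℤ} (M≥0 : 0ℤ ≤ M) where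

  private
    unit : Fin n → Fin n → ℤ
    unit i u = ⟦ single i u ⟧

    -- The quadratic coefficient along one coordinate could come only from a loop, which asymmetry
    -- excludes.
    unit-form : ∀ i → form B (unit i) (unit i) ≡ 0ℤ
    unit-form i = ∑-zero λ u → ∑-zero λ v → vanish u v
      where
      vanish : ∀ u v → ⟦ B u v ⟧ * (unit i u * unit i v) ≡ 0ℤ
      vanish u v with i Fin.≟ u | i Fin.≟ v
      ... | no _ | _ = *-zeroʳ ⟦ B u v ⟧
      ... | yes _ | no _ = *-zeroʳ ⟦ B u v ⟧
      ... | yes refl | yes refl with B i i in eq
      ...   | false = refl
      ...   | true = ⊥-elim (loopless asym eq refl)

    -- The last component protects the coordinates that are already rounded, so a single pass over
    -- all coordinates suffices.
    Improves : (Fin n → ℤ) → (Fin n → ℤ) → Set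
    Improves z z′ = (∀ u → Bounded M (z′ u)) × form B z′ z′ ≤ form B z z × (∀ u → Extreme M (z u) → Extreme M (z′ u))

    -- form B z z is affine in each single coordinate of z.
    round-at : ∀ i z → (∀ u → Bounded M (z u)) → ∃ λ z′ → Improves z z′ × Extreme M (z′ i)
    round-at i z bounded = choose (≤-total L 0ℤ)
      where
      L = form B z (unit i) + form B (unit i) z
      move : ℤ → Fin n → ℤ
      move t u = z u + t * unit i u
      move-form : ∀ t → t * L ≤ 0ℤ → form B (move t) (move t) ≤ form B z z
      move-form t p = certify (trans (cong (λ f → form B z z - f)
          (trans (form-shift B z (unit i) t) (cong (λ f → form B z z + t * L + t * t * f) (unit-form i))))
          (id (form B z z) (t * L) t)) (neg-mono-≤ p)
        where
        id : ∀ f l t → f - (f + l + t * t * 0ℤ) ≡ - l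
        id = solve-∀
      moved : ∀ b u → i ≡ u → move (M * sgn b - z i) u ≡ M * sgn b
      moved b u refl with i Fin.≟ i
      ... | yes _ = id (M * sgn b) (z i)
        where
        id : ∀ m x → x + (m - x) * 1ℤ ≡ m
        id = solve-∀
      ... | no ¬p = ⊥-elim (¬p refl)
      unmoved : ∀ t u → i ≢ u → move t u ≡ z u
      unmoved t u i≢u with i Fin.≟ u
      ... | yes p = ⊥-elim (i≢u p)
      ... | no _ = trans (cong (λ s → z u + s) (*-zeroʳ t)) (+-identityʳ (z u))
      sgn-bounded : ∀ b → Bounded M (M * sgn b)
      sgn-bounded true = subst (Bounded M) (sym (*-identityʳ M)) (≤-trans (neg-mono-≤ M≥0) M≥0 , ≤-refl)
      sgn-bounded false = subst (Bounded M) (id M) (Bounded-neg (≤-trans (neg-mono-≤ M≥0) M≥0 , ≤-refl))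
        where
        id : ∀ M → - M ≡ M * -1ℤ
        id = solve-∀
      result : ∀ b → (M * sgn b - z i) * L ≤ 0ℤ → ∃ λ z′ → Improves z z′ × Extreme M (z′ i)
      result b p = move t , (move-bounded , move-form t p , move-extreme) , (b , moved b i refl)
        where
        t = M * sgn b - z i
        move-bounded : ∀ u → Bounded M (move t u)
        move-bounded u with i Fin.≟ u in eq
        ... | yes p = subst (Bounded M) (trans (sym (moved b u p)) (cong (λ d → z u + t * ⟦ does d ⟧) eq))
            (sgn-bounded b)
        ... | no ¬p = subst (Bounded M) (trans (sym (unmoved t u ¬p)) (cong (λ d → z u + t * ⟦ does d ⟧) eq))
            (bounded u)
        move-extreme : ∀ u → Extreme M (z u) → Extreme M (move t u)
        move-extreme u (c , e) with i Fin.≟ u in eq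
        ... | yes p = b , trans (cong (λ d → z u + t * ⟦ does d ⟧) (sym eq)) (moved b u p)
        ... | no ¬p = c , trans (cong (λ d → z u + t * ⟦ does d ⟧) (sym eq)) (trans (unmoved t u ¬p) e)
      choose : L ≤ 0ℤ ⊎ 0ℤ ≤ L → ∃ λ z′ → Improves z z′ × Extreme M (z′ i)
      choose (inj₁ p) = result true (certify (id M (z i) L) (gap (proj₂ (bounded i)) ⊗ gap p))
        where
        id : ∀ M x l → 0ℤ - (M * 1ℤ - x) * l ≡ (M - x) * (0ℤ - l)
        id = solve-∀
      choose (inj₂ p) = result false (certify (id M (z i) L) (gap (proj₁ (bounded i)) ⊗ p))
        where
        id : ∀ M x l → 0ℤ - (M * -1ℤ - x) * l ≡ (x - - M) * l
        id = solve-∀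

    round-along : ∀ k (f : Fin k → Fin n) z → (∀ u → Bounded M (z u)) → ∃ λ z′ → Improves z z′ ×
        (∀ j → Extreme M (z′ (f j)))
    round-along zero f z bounded = z , (bounded , ≤-refl , λ _ e → e) , λ ()
    round-along (suc k) f z bounded with round-along k (f ∘ suc) z bounded
    ... | z₁ , (bounded₁ , form₁ , extreme₁) , done with round-at (f zero) z₁ bounded₁
    ...   | z₂ , (bounded₂ , form₂ , extreme₂) , new =
      z₂ , (bounded₂ , ≤-trans form₂ form₁ , λ u → extreme₂ u ∘ extreme₁ u) , λ { zero → new ; (suc j) → extreme₂ _ (done j) }

  round : ∀ z → (∀ u → Bounded M (z u)) → ∃ λ (b : Fin n → Bool) → M * M * form B (sgn ∘ b) (sgn ∘ b) ≤ form B z z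
  round z bounded with round-along n (λ i → i) z bounded
  ... | z′ , (_ , z′-form , _) , extreme = b , subst (_≤ form B z z) scaled z′-form
    where
    b : Fin n → Bool
    b u = proj₁ (extreme u)
    id : ∀ c M x y → c * (M * x * (M * y)) ≡ M * M * (c * (x * y))
    id = solve-∀
    scaled : form B z′ z′ ≡ M * M * form B (sgn ∘ b) (sgn ∘ b)
    scaled = trans (sum-cong-≗ λ u → sum-cong-≗ λ v → trans
        (cong₂ (λ x y → ⟦ B u v ⟧ * (x * y)) (proj₂ (extreme u)) (proj₂ (extreme v)))
        (id ⟦ B u v ⟧ M (sgn (b u)) (sgn (b v))))
      (∑∑-*ˡ (M * M) λ u v → ⟦ B u v ⟧ * (sgn (b u) * sgn (b v)))

-- Chosen pairs in few triangles

edgeCount : Relation n → ℤ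
edgeCount R = ∑ λ v → size λ w → R w v

∧-true : ∀ {a b} → a ∧ b ≡ true → a ≡ true × b ≡ true
∧-true {true} {true} _ = refl , refl

not-true : ∀ {a} → not a ≡ true → a ≡ false
not-true {false} _ = refl

⟦∧⟧ : ∀ a b → ⟦ a ∧ b ⟧ ≡ ⟦ a ⟧ * ⟦ b ⟧
⟦∧⟧ true b = sym (*-identityˡ ⟦ b ⟧)
⟦∧⟧ false b = refl

module _ {B V : Relation n} (asym : Asymmetric B) (V⊆B : ∀ {w v} → V w v ≡ true → B w v ≡ true) where

  private module U = Expectation 1ℤ pos≥0

  -- Under uniformly random roles an edge runs from a source to a target with probability 1/4; its
  -- ends are distinct, so their roles are independent.
  split-roles : ∃ λ (Q : Fin n → Bool) → edgeCount V ≤ + 4 * edgeCount (λ w v → V w v ∧ (Q w ∧ not (Q v)))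
  split-roles with U.𝔼-attained {x = edgeCount V} tally (subst (λ e → U.q ^ n * edgeCount V ≤ e) (sym mean) ≤-refl)
    where
    tally : Vec Bool n → ℤ
    tally y = ∑ λ v → ∑ λ w → + 4 * (⟦ V w v ⟧ * (⟦ lookup y w ⟧ * ⟦ not (lookup y v) ⟧))
    pair-mean : ∀ v w → U.𝔼 (λ y → + 4 * (⟦ V w v ⟧ * (⟦ lookup y w ⟧ * ⟦ not (lookup y v) ⟧))) ≡ U.q ^ n * ⟦ V w v ⟧
    pair-mean v w = trans (U.𝔼-* (+ 4) λ y → ⟦ V w v ⟧ * (⟦ lookup y w ⟧ * ⟦ not (lookup y v) ⟧))
        (trans (cong (+ 4 *_) (U.𝔼-* ⟦ V w v ⟧ λ y → ⟦ lookup y w ⟧ * ⟦ not (lookup y v) ⟧)) evaluate)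
      where
      id : ∀ m → + 4 * (0ℤ * m) ≡ 0ℤ
      id = solve-∀
      evaluate : + 4 * (⟦ V w v ⟧ * U.𝔼 (λ y → ⟦ lookup y w ⟧ * ⟦ not (lookup y v) ⟧)) ≡ U.q ^ n * ⟦ V w v ⟧
      evaluate with V w v in eq
      ... | false = trans (id (U.𝔼 (λ y → ⟦ lookup y w ⟧ * ⟦ not (lookup y v) ⟧))) (sym (*-zeroʳ (U.q ^ n)))
      ... | true = trans (cong (+ 4 *_) (*-identityˡ _))
          (U.𝔼-lookup₂ {n} w v ⟦_⟧ (⟦_⟧ ∘ not) (loopless asym (V⊆B eq)))
    mean : U.𝔼 tally ≡ U.q ^ n * edgeCount V
    mean = trans (U.𝔼-∑ λ v y → ∑ λ w → + 4 * (⟦ V w v ⟧ * (⟦ lookup y w ⟧ * ⟦ not (lookup y v) ⟧)))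
      (trans (sum-cong-≗ λ v → trans (U.𝔼-∑ λ w y → + 4 * (⟦ V w v ⟧ * (⟦ lookup y w ⟧ * ⟦ not (lookup y v) ⟧)))
          (sum-cong-≗ (pair-mean v)))
        (∑∑-*ˡ (U.q ^ n) λ v w → ⟦ V w v ⟧))
  ... | y , p = lookup y , subst (edgeCount V ≤_)
      (trans (∑∑-*ˡ (+ 4) λ v w → ⟦ V w v ⟧ * (⟦ lookup y w ⟧ * ⟦ not (lookup y v) ⟧))
      (cong (+ 4 *_) (sum-cong-≗ λ v → sum-cong-≗ λ w → sym
          (trans (⟦∧⟧ (V w v) _) (cong (⟦ V w v ⟧ *_) (⟦∧⟧ (lookup y w) _)))))) p

  -- The clipping level 8 D makes the gain on the edges of V twice the loss on pairs with common sources.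
  few-triangles : ∀ {s D} → (∀ v → size (λ w → V w v) ≤ s) → 0ℤ < D → s ≤ + 16 * (D * D) →
    (∀ {w v} → V w v ≡ true → ∑ (λ u → ⟦ B u v ⟧ * ⟦ V w u ⟧) ≤ D) →
    ∃ λ (b : Fin n → Bool) → edgeCount V ≤ + 256 * D * - form B (sgn ∘ b) (sgn ∘ b)
  few-triangles {s} {D} V≤s D>0 s≤D² codegree = proj₁ rounded , final
    where
    Q = proj₁ split-roles
    R : Relation n
    R w v = V w v ∧ (Q w ∧ not (Q v))
    R⊆V : ∀ {w v} → R w v ≡ true → V w v ≡ true
    R⊆V = proj₁ ∘ ∧-true
    ⟦R⟧≤⟦V⟧ : ∀ w v → ⟦ R w v ⟧ ≤ ⟦ V w v ⟧
    ⟦R⟧≤⟦V⟧ w v with V w v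
    ... | true = ⟦⟧≤1 _
    ... | false = ≤-refl
    M = + 8 * D
    D≥0 = <⇒≤ D>0
    M>0 : 0ℤ < M
    M>0 = *-monoˡ-<-pos (+ 8) D>0
    small : ∀ v → + 4 * size (λ w → R w v) ≤ M * M
    small v = certify (id D s _ _) (pos≥0 {4} ⊗ gap s≤D² ⊕ pos≥0 {4} ⊗ gap (V≤s v) ⊕ pos≥0 {4} ⊗ gap
        (∑-mono λ w → ⟦R⟧≤⟦V⟧ w v))
      where
      id : ∀ D s k k′ → + 8 * D * (+ 8 * D) - + 4 * k ≡ + 4 * (+ 16 * (D * D) - s) + + 4 * (s - k′) + + 4 * (k′ - k)
      id = solve-∀
    open Opposing {B = B} asym Q R M M>0 (V⊆B ∘ R⊆V)
      (λ {w} {v} p → proj₁ (∧-true {Q w} (proj₂ (∧-true {V w v} p))))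
      (λ {w} {v} p → not-true (proj₂ (∧-true {Q w} (proj₂ (∧-true {V w v} p))))) small
    y = proj₁ opposing-form
    rounded = Rounding.round asym (<⇒≤ M>0) (λ u → opinion u y) (λ u → opinion-bounded u y)
    -- The triples counted by `overlaps` are regrouped by the edge of `R` from `i` to `v`; the
    -- codegree hypothesis then bounds the choices of `u`.
    overlaps-bound : overlaps ≤ D * edgeCount R
    overlaps-bound = subst₂ _≤_ (sym rearrange) (∑∑-*ˡ D λ v i → ⟦ R i v ⟧) (∑-mono λ v → ∑-mono (bound v))
      where
      rearrange : overlaps ≡ ∑ λ v → ∑ λ i → ⟦ R i v ⟧ * ∑ λ u → ⟦ B u v ⟧ * ⟦ R i u ⟧
      rearrange = trans (∑-comm λ u v → ⟦ B u v ⟧ * ∑ λ i → ⟦ R i u ⟧ * ⟦ R i v ⟧) (sum-cong-≗ λ v →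
        trans (sum-cong-≗ λ u → sym (∑-*ˡ ⟦ B u v ⟧ λ i → ⟦ R i u ⟧ * ⟦ R i v ⟧))
          (trans (∑-comm λ u i → ⟦ B u v ⟧ * (⟦ R i u ⟧ * ⟦ R i v ⟧))
            (sum-cong-≗ λ i → trans (sum-cong-≗ λ u → id ⟦ B u v ⟧ ⟦ R i u ⟧ ⟦ R i v ⟧)
                (∑-*ˡ ⟦ R i v ⟧ λ u → ⟦ B u v ⟧ * ⟦ R i u ⟧))))
        where
        id : ∀ a b c → a * (b * c) ≡ c * (a * b)
        id = solve-∀
      bound : ∀ v i → ⟦ R i v ⟧ * ∑ (λ u → ⟦ B u v ⟧ * ⟦ R i u ⟧) ≤ D * ⟦ R i v ⟧
      bound v i with R i v in eq
      ... | false = ≤-reflexive (sym (*-zeroʳ D))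
      ... | true = subst₂ _≤_ (sym (*-identityˡ (∑ λ u → ⟦ B u v ⟧ * ⟦ R i u ⟧))) (sym (*-identityʳ D))
        (≤-trans (∑-mono λ u → scale (⟦⟧≥0 (B u v)) (⟦R⟧≤⟦V⟧ i u)) (codegree (R⊆V eq)))
    φ = form B (sgn ∘ proj₁ rounded) (sgn ∘ proj₁ rounded)
    combined : D * edgeCount R ≤ D * (+ 64 * D * - φ)
    combined = cancel-pos {+ 4} pos>0
        (certify (id D (edgeCount R) overlaps (form B (λ u → opinion u y) (λ u → opinion u y)) φ)
      (gap (proj₂ opposing-form) ⊕ pos≥0 {4} ⊗ gap overlaps-bound ⊕ pos≥0 {4} ⊗ gap (proj₂ rounded)))
      where
      id : ∀ D ρ o f φ → + 4 * (D * (+ 64 * D * - φ)) - + 4 * (D * ρ) ≡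
        - + 4 * f - (+ 8 * D * ρ - + 4 * o) + + 4 * (D * ρ - o) + + 4 * (f - + 8 * D * (+ 8 * D) * φ)
      id = solve-∀
    final : edgeCount V ≤ + 256 * D * - φ
    final = certify (id D (edgeCount V) (edgeCount R) φ)
        (gap (proj₂ split-roles) ⊕ pos≥0 {4} ⊗ gap (cancel-pos D>0 combined))
      where
      id : ∀ D e r φ → + 256 * D * - φ - e ≡ + 4 * r - e + + 4 * (+ 64 * D * - φ - r)
      id = solve-∀

-- Chosen pairs in many triangles: random clusters

∑-term : {f : Fin n → ℤ} → (∀ i → 0ℤ ≤ f i) → ∀ i → f i ≤ ∑ f
∑-term {f = f} f≥0 zero = certify (id (f zero) _) (∑≥0 (f≥0 ∘ suc))
  where
  id : ∀ x y → x + y - x ≡ y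
  id = solve-∀
∑-term {f = f} f≥0 (suc i) = certify (id (f zero) _ (f (suc i))) (f≥0 zero ⊕ gap (∑-term (f≥0 ∘ suc) i))
  where
  id : ∀ x y z → x + y - z ≡ x + (y - z)
  id = solve-∀

∑-single : (w : Fin n) → ∑ (λ i → ⟦ single w i ⟧) ≡ 1ℤ
∑-single {suc n} zero = +-congˡ 1ℤ (∑-zero {n} λ _ → refl)
∑-single (suc w) = trans (+-identityˡ _) (∑-single w)

restrict : Relation n → (Fin n → Bool) → Relation n
restrict B S u v = B u v ∧ (S u ∧ S v)

-- Masking the vector instead of the relation turns solutions on different clusters into vectors
-- that can be added.
form-restrict : (B : Relation n) (S : Fin n → Bool) (x : Fin n → ℤ) →
  form (restrict B S) x x ≡ form B (λ u → ⟦ S u ⟧ * x u) (λ u → ⟦ S u ⟧ * x u)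
form-restrict B S x = sum-cong-≗ λ u → sum-cong-≗ λ v →
  trans (cong (_* (x u * x v)) (trans (⟦∧⟧ (B u v) _) (cong (⟦ B u v ⟧ *_) (⟦∧⟧ (S u) (S v)))))
      (id ⟦ B u v ⟧ ⟦ S u ⟧ ⟦ S v ⟧ (x u) (x v))
  where
  id : ∀ b s t x y → b * (s * t) * (x * y) ≡ b * (s * x * (t * y))
  id = solve-∀

indegree : Relation n → Fin n → ℤ
indegree B v = size λ u → B u v

atLeast : ℤ → Relation n → Fin n → Bool
atLeast s B v = does (s ≤? indegree B v)

sgn-bounded : ∀ b → Bounded 1ℤ (sgn b)
sgn-bounded true = -≤+ , ≤-refl
sgn-bounded false = ≤-refl , -≤+

-- If `β` and `α` hold, either `N` is 1 and there is no penalty, or the integer `N` is at least 2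
-- and the penalty cancels the vertex.
survivor : ∀ β α N → (α ≡ true → 1ℤ ≤ N) → ⟦ β ⟧ * ⟦ α ⟧ - ⟦ β ⟧ * ⟦ α ⟧ * (N - 1ℤ) ≤
    ⟦ β ∧ ((α ∧ does (N ≤? 1ℤ)) ∧ true) ⟧
survivor false α N _ = ≤-reflexive (id ⟦ α ⟧ N)
  where
  id : ∀ a x → 0ℤ * a - 0ℤ * a * (x - 1ℤ) ≡ 0ℤ
  id = solve-∀
survivor true false N _ = ≤-reflexive (id N)
  where
  id : ∀ x → 1ℤ * 0ℤ - 1ℤ * 0ℤ * (x - 1ℤ) ≡ 0ℤ
  id = solve-∀
survivor true true N 1≤N with N ≤? 1ℤ
... | yes _ = certify (id N) (gap (1≤N refl))
  where
  id : ∀ x → 1ℤ - (1ℤ * 1ℤ - 1ℤ * 1ℤ * (x - 1ℤ)) ≡ x - 1ℤ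
  id = solve-∀
... | no ¬p = certify (id N) (gap (i<j⇒suc[i]≤j (≰⇒> ¬p)))
  where
  id : ∀ x → 0ℤ - (1ℤ * 1ℤ - 1ℤ * 1ℤ * (x - 1ℤ)) ≡ x - (1ℤ + 1ℤ)
  id = solve-∀

survivors : ∀ (β α : Fin n → Bool) (N : Fin n → ℤ) → (∀ u → α u ≡ true → 1ℤ ≤ N u) →
  ∑ (λ u → ⟦ β u ⟧ * ⟦ α u ⟧) - ∑ (λ u → ⟦ β u ⟧ * ⟦ α u ⟧ * (N u - 1ℤ)) ≤ size
      (λ u → β u ∧ ((α u ∧ does (N u ≤? 1ℤ)) ∧ true))
survivors β α N N≥1 = ≤-trans (≤-reflexive (sym (trans (∑-distrib-+ g (λ u → - c u)) (+-congˡ (∑ g) (∑-neg c)))))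
    (∑-mono λ u → survivor (β u) (α u) (N u) (N≥1 u))
  where
  g c : Fin _ → ℤ
  g u = ⟦ β u ⟧ * ⟦ α u ⟧
  c u = g u * (N u - 1ℤ)

-- The left side is `2 b - b x - 2 C`. For `x ≥ 2` it is nonpositive. For `x = 1` it is `b - 2 C`,
-- hence at most `b`; and if moreover `d < t`, then `b - C < t ≤ b / 2`, so it is again nonpositive.
payoff-arith : ∀ {b x C t d} (x≤?1 : Dec (x ≤ 1ℤ)) (t≤?d : Dec (t ≤ d)) → 0ℤ ≤ b → 0ℤ ≤ C → 1ℤ ≤ x → + 2 * t ≤ b →
    (x ≤ 1ℤ → b - C ≤ d) →
  + 4 * b * 1ℤ + (- b * (1ℤ * x) + - + 2 * (C + b)) ≤ b * ⟦ does x≤?1 ∧ does t≤?d ⟧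
payoff-arith {b} {x} {C} (no x≰1) _ b≥0 C≥0 x≥1 dense _ = certify (id b x C)
    (b≥0 ⊗ gap (i<j⇒suc[i]≤j (≰⇒> x≰1)) ⊕ pos≥0 {2} ⊗ C≥0)
  where
  id : ∀ b x c → b * 0ℤ - (+ 4 * b * 1ℤ + (- b * (1ℤ * x) + - + 2 * (c + b))) ≡ b * (x - (1ℤ + 1ℤ)) + + 2 * c
  id = solve-∀
payoff-arith {b} {x} {C} (yes _) (yes _) b≥0 C≥0 x≥1 dense _ = certify (id b x C) (b≥0 ⊗ gap x≥1 ⊕ pos≥0 {2} ⊗ C≥0)
  where
  id : ∀ b x c → b * 1ℤ - (+ 4 * b * 1ℤ + (- b * (1ℤ * x) + - + 2 * (c + b))) ≡ b * (x - 1ℤ) + + 2 * c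
  id = solve-∀
payoff-arith {b} {x} {C} {t} {d} (yes x≤1) (no t≰d) b≥0 C≥0 x≥1 dense left =
  certify (id b x C t d) (b≥0 ⊗ gap x≥1 ⊕ pos≥0 {2} ⊗ gap (left x≤1) ⊕ gap dense ⊕ pos≥0 {2} ⊗ gap (<⇒≤ (≰⇒> t≰d)))
  where
  id : ∀ b x c t d → b * 0ℤ - (+ 4 * b * 1ℤ + (- b * (1ℤ * x) + - + 2 * (c + b))) ≡
      b * (x - 1ℤ) + + 2 * (d - (b - c)) + (b - + 2 * t) + + 2 * (t - d)
  id = solve-∀

-- This minorises the event that a pair is good by an expression of degree two in the sample, so
-- that its mean follows from pairwise independence. Here `x` says that `w` is sampled, `N u` counts
-- the sampled choices of `u`, and `b` is the codegree.
payoff-bound : ∀ {v t} (β α : Fin n → Bool) (N : Fin n → ℤ) → α v ≡ true → (x : Bool) →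
    (x ≡ true → ∀ u → α u ≡ true → 1ℤ ≤ N u) →
  0ℤ < t → + 2 * t ≤ ∑ (λ u → ⟦ β u ⟧ * ⟦ α u ⟧) → let b = ∑ (λ u → ⟦ β u ⟧ * ⟦ α u ⟧); S = λ u → α u ∧ (x ∧ does (N u ≤? 1ℤ)) in
  + 4 * b * ⟦ x ⟧ + (- b * (⟦ x ⟧ * N v) + - + 2 * ∑ (λ u → ⟦ β u ⟧ * ⟦ α u ⟧ * (⟦ x ⟧ * N u))) ≤
      b * ⟦ S v ∧ does (t ≤? size (λ u → β u ∧ (S u ∧ S v))) ⟧
payoff-bound {n} {v} β α N αv false _ t>0 dense = ≤-trans
    (≤-reflexive (trans (cong (λ z → + 4 * b * 0ℤ + (- b * (0ℤ * N v) + - + 2 * z))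
    (∑-zero λ u → *-zeroʳ (⟦ β u ⟧ * ⟦ α u ⟧))) (id b (N v)))) (∑≥0 (λ u → ⟦⟧≥0 (β u) ⊗ ⟦⟧≥0 (α u)) ⊗ ⟦⟧≥0 _)
  where
  b = ∑ λ u → ⟦ β u ⟧ * ⟦ α u ⟧
  id : ∀ b x → + 4 * b * 0ℤ + (- b * (0ℤ * x) + - + 2 * 0ℤ) ≡ 0ℤ
  id = solve-∀
payoff-bound {n} {v} {t} β α N αv true N≥1 t>0 dense = subst₂
    (λ z a → + 4 * b * 1ℤ + (- b * (1ℤ * N v) + - + 2 * z) ≤
    b * ⟦ (a ∧ low) ∧ does (t ≤? size (λ u → β u ∧ (S u ∧ (a ∧ low)))) ⟧)
    (sym spill-split) (sym αv) (payoff-arith (N v ≤? 1ℤ) (t ≤? size (λ u → β u ∧ (S u ∧ low)))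
        (∑≥0 λ u → ⟦⟧≥0 (β u) ⊗ ⟦⟧≥0 (α u)) (∑≥0 c≥0) (N≥1 refl v αv) dense left)
  where
  g c : Fin n → ℤ
  g u = ⟦ β u ⟧ * ⟦ α u ⟧
  c u = g u * (N u - 1ℤ)
  b = ∑ g
  S : Fin n → Bool
  S u = α u ∧ does (N u ≤? 1ℤ)
  low = does (N v ≤? 1ℤ)
  c≥0 : ∀ u → 0ℤ ≤ c u
  c≥0 u = nonneg (α u) refl
    where
    id : ∀ b x → 0ℤ ≡ b * 0ℤ * x
    id = solve-∀
    nonneg : ∀ a → α u ≡ a → 0ℤ ≤ ⟦ β u ⟧ * ⟦ a ⟧ * (N u - 1ℤ)
    nonneg true eq = ⟦⟧≥0 (β u) ⊗ pos≥0 {1} ⊗ gap (N≥1 refl u eq)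
    nonneg false eq = ≤-reflexive (id ⟦ β u ⟧ (N u - 1ℤ))
  spill-split : ∑ (λ u → g u * (1ℤ * N u)) ≡ ∑ c + b
  spill-split = trans (sum-cong-≗ λ u → id (g u) (N u)) (∑-distrib-+ c g)
    where
    id : ∀ g x → g * (1ℤ * x) ≡ g * (x - 1ℤ) + g
    id = solve-∀
  left : N v ≤ 1ℤ → b - ∑ c ≤ size (λ u → β u ∧ (S u ∧ low))
  left p = subst (λ a → b - ∑ c ≤ size (λ u → β u ∧ (S u ∧ a))) (sym (dec-true (N v ≤? 1ℤ) p))
      (survivors β α N (N≥1 refl))

-- At sampling probability `1 / (c s)` the positive term contributes `4 b / (c s)`, and the
-- penalties cost at most three times `b (1 + c) / (c * c * s)`. What remains is
-- `b (c - 3) / (c * c * s)`, largest at `c = 6`, where it is `b / (12 s)`.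
mean-arith : ∀ {b q s m e f g h} → 0ℤ < s → 0ℤ < b → q ≡ + 6 * s → q * e ≡ m →
  + 4 * b * e + (- b * f + - + 2 * g) ≤ b * h → q * q * f ≤ m * (s + q) → q * q * g ≤ b * (m * (s + q)) → m ≤
      + 12 * s * h
mean-arith {b} {s = s} {e = e} {f} {g} {h} s>0 b>0 refl refl above f≤ g≤ = cancel-pos (*-monoˡ-<-pos (+ 3) s>0)
    (cancel-pos b>0
  (certify (id b s e f g h) (sq≥0 (+ 6 * s) ⊗ gap above ⊕ <⇒≤ b>0 ⊗ gap f≤ ⊕ pos≥0 {2} ⊗ gap g≤)))
  where
  id : ∀ b s e f g h → b * (+ 3 * s * (+ 12 * s * h)) - b * (+ 3 * s * (+ 6 * s * e)) ≡
    + 6 * s * (+ 6 * s) * (b * h - (+ 4 * b * e + (- b * f + - + 2 * g)))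
    + b * (+ 6 * s * e * (s + + 6 * s) - + 6 * s * (+ 6 * s) * f) + + 2
        * (b * (+ 6 * s * e * (s + + 6 * s)) - + 6 * s * (+ 6 * s) * g)
  id = solve-∀

-- Sample every vertex with probability 1 / 6s; cluster w consists of the v whose only sampled element of A _ v is w.
module Sampling {B A : Relation n} {s t : ℤ} (A≤s : ∀ v → size (λ w → A w v) ≤ s) (s>0 : 0ℤ < s) (t>0 : 0ℤ < t) where

  private
    s≥0 = <⇒≤ s>0

    α≥0 : 0ℤ ≤ + 6 * s - 1ℤ
    α≥0 = gap {1ℤ} {+ 6 * s} (≤-trans (i<j⇒suc[i]≤j s>0) (certify (id s) (pos≥0 {5} ⊗ s≥0)))
      where
      id : ∀ s → + 6 * s - s ≡ + 5 * s
      id = solve-∀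

    module E = Expectation (+ 6 * s - 1ℤ) α≥0

    m = E.q ^ n

    q≡6s : E.q ≡ + 6 * s
    q≡6s = id s
      where
      id : ∀ s → + 6 * s - 1ℤ + 1ℤ ≡ + 6 * s
      id = solve-∀

    m≥0 : 0ℤ ≤ m
    m≥0 = <⇒≤ (E.mass>0 n)

    unit-weight : (+ 6 * s - 1ℤ) * 0ℤ + 1ℤ ≡ 1ℤ
    unit-weight = id s
      where
      id : ∀ s → (+ 6 * s - 1ℤ) * 0ℤ + 1ℤ ≡ 1ℤ
      id = solve-∀

  sampled : Vec Bool n → Fin n → ℤ
  sampled y u = ∑ λ w → ⟦ A w u ⟧ * ⟦ lookup y w ⟧

  cluster : Vec Bool n → Relation n
  cluster y w u = A w u ∧ (lookup y w ∧ does (sampled y u ≤? 1ℤ))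

  -- These are the pairs for which the induction hypothesis inside the cluster of `w` counts the
  -- vertex `v`.
  good : Vec Bool n → Relation n
  good y w v = cluster y w v ∧ atLeast t (restrict B (cluster y w)) v

  cluster-disjoint : ∀ y u → ∑ (λ w → ⟦ cluster y w u ⟧) ≤ 1ℤ
  cluster-disjoint y u with sampled y u ≤? 1ℤ
  ... | yes p = ≤-trans (≤-reflexive
      (sum-cong-≗ λ w → trans (⟦∧⟧ (A w u) _) (cong (⟦ A w u ⟧ *_) (trans (⟦∧⟧ (lookup y w) true) (*-identityʳ _)))))
      p
  ... | no _ = ≤-trans (≤-reflexive
      (∑-zero λ w → trans (⟦∧⟧ (A w u) _)
      (trans (cong (⟦ A w u ⟧ *_) (trans (⟦∧⟧ (lookup y w) false) (*-zeroʳ ⟦ lookup y w ⟧))) (*-zeroʳ ⟦ A w u ⟧))))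
      pos≥0

  codegree : Fin n → Fin n → ℤ
  codegree w v = ∑ λ u → ⟦ B u v ⟧ * ⟦ A w u ⟧

  private
    both-mean : ∀ w w′ → E.q * E.q * E.𝔼 {n} (λ y → ⟦ lookup y w ⟧ * ⟦ lookup y w′ ⟧) ≤
        m * (1ℤ + E.q * ⟦ single w w′ ⟧)
    both-mean w w′ with w Fin.≟ w′
    ... | no p = ≤-reflexive (trans (E.𝔼-lookup₂ w w′ ⟦_⟧ ⟦_⟧ p)
        (trans (cong (λ x → m * (x * x)) unit-weight) (id m E.q)))
      where
      id : ∀ m q → m * (1ℤ * 1ℤ) ≡ m * (1ℤ + q * 0ℤ)
      id = solve-∀
    ... | yes refl = certify (id m E.q _ exact) m≥0
      where
      exact : E.q * E.𝔼 {n} (λ y → ⟦ lookup y w ⟧ * ⟦ lookup y w ⟧) ≡ m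
      exact = trans (cong (E.q *_) (E.𝔼-cong λ y → ⟦⟧-idem (lookup y w)))
          (trans (E.𝔼-lookup w ⟦_⟧) (trans (cong (m *_) unit-weight) (*-identityʳ m)))
      id′ : ∀ q e → q * e * (1ℤ + q * 1ℤ) - q * q * e ≡ q * e
      id′ = solve-∀
      id : ∀ m q e → q * e ≡ m → m * (1ℤ + q * 1ℤ) - q * q * e ≡ m
      id _ q e refl = id′ q e

    -- Each of the at most `s` choices of `u` other than `w` is sampled together with `w` with
    -- probability `1 / (q * q)`; `w` itself may be among the choices, once, and then adds `1 / q`.
    sampled-mean : ∀ w u → E.q * E.q * E.𝔼 (λ y → ⟦ lookup y w ⟧ * sampled y u) ≤ m * (s + E.q)
    sampled-mean w u = ≤-trans (≤-reflexive expand)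
        (≤-trans (∑-mono bound) (≤-trans (≤-reflexive total)
        (scale m≥0 (+-mono-≤ (A≤s u) (≤-trans (scale (<⇒≤ E.q>0) at-most-one) (≤-reflexive (*-identityʳ E.q)))))))
      where
      pair : Fin n → Vec Bool n → ℤ
      pair w′ y = ⟦ lookup y w ⟧ * ⟦ lookup y w′ ⟧
      swap : ∀ a b c → a * (b * c) ≡ b * (a * c)
      swap = solve-∀
      expand : E.q * E.q * E.𝔼 (λ y → ⟦ lookup y w ⟧ * sampled y u) ≡ ∑ λ w′ →
          ⟦ A w′ u ⟧ * (E.q * E.q * E.𝔼 (pair w′))
      expand = trans (cong (E.q * E.q *_)
          (trans (E.𝔼-cong λ y → trans (sym (∑-*ˡ ⟦ lookup y w ⟧ λ w′ → ⟦ A w′ u ⟧ * ⟦ lookup y w′ ⟧))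
          (sum-cong-≗ λ w′ → swap ⟦ lookup y w ⟧ ⟦ A w′ u ⟧ _))
          (trans (E.𝔼-∑ λ w′ y → ⟦ A w′ u ⟧ * pair w′ y) (sum-cong-≗ λ w′ → E.𝔼-* ⟦ A w′ u ⟧ (pair w′)))))
        (trans (sym (∑-*ˡ (E.q * E.q) λ w′ → ⟦ A w′ u ⟧ * E.𝔼 (pair w′)))
            (sum-cong-≗ λ w′ → swap (E.q * E.q) ⟦ A w′ u ⟧ _))
      bound : ∀ w′ → ⟦ A w′ u ⟧ * (E.q * E.q * E.𝔼 (pair w′)) ≤
          m * (⟦ A w′ u ⟧ + E.q * (⟦ A w′ u ⟧ * ⟦ single w w′ ⟧))
      bound w′ = ≤-trans (scale (⟦⟧≥0 (A w′ u)) (both-mean w w′)) (≤-reflexive (id ⟦ A w′ u ⟧ m E.q ⟦ single w w′ ⟧))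
        where
        id : ∀ a m q d → a * (m * (1ℤ + q * d)) ≡ m * (a + q * (a * d))
        id = solve-∀
      total : ∑ (λ w′ → m * (⟦ A w′ u ⟧ + E.q * (⟦ A w′ u ⟧ * ⟦ single w w′ ⟧))) ≡
          m * (size (λ w′ → A w′ u) + E.q * ∑ λ w′ → ⟦ A w′ u ⟧ * ⟦ single w w′ ⟧)
      total = trans (∑-*ˡ m λ w′ → ⟦ A w′ u ⟧ + E.q * (⟦ A w′ u ⟧ * ⟦ single w w′ ⟧)) (cong (m *_)
        (trans (∑-distrib-+ (λ w′ → ⟦ A w′ u ⟧) (λ w′ → E.q * (⟦ A w′ u ⟧ * ⟦ single w w′ ⟧)))
            (+-congˡ (size λ w′ → A w′ u) (∑-*ˡ E.q λ w′ → ⟦ A w′ u ⟧ * ⟦ single w w′ ⟧))))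
      at-most-one : ∑ (λ w′ → ⟦ A w′ u ⟧ * ⟦ single w w′ ⟧) ≤ 1ℤ
      at-most-one = ≤-trans (∑-mono λ w′ → below (A w′ u) (single w w′)) (≤-reflexive (∑-single w))
        where
        below : ∀ a d → ⟦ a ⟧ * ⟦ d ⟧ ≤ ⟦ d ⟧
        below true d = ≤-reflexive (*-identityˡ ⟦ d ⟧)
        below false d = ⟦⟧≥0 d

    sampled≥1 : ∀ {y w u} → A w u ≡ true → lookup y w ≡ true → 1ℤ ≤ sampled y u
    sampled≥1 {y} {w} {u} p q = subst (_≤ sampled y u) (cong₂ (λ a b → ⟦ a ⟧ * ⟦ b ⟧) p q)
        (∑-term (λ i → ⟦⟧≥0 (A i u) ⊗ ⟦⟧≥0 (lookup y i)) w)

    module Pair {w v} (Awv : A w v ≡ true) (dense : + 2 * t ≤ codegree w v) where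

      b = codegree w v

      b>0 : 0ℤ < b
      b>0 = <-≤-trans (*-monoˡ-<-pos (+ 2) t>0) dense

      spill : Vec Bool n → ℤ
      spill y = ∑ λ u → ⟦ B u v ⟧ * ⟦ A w u ⟧ * (⟦ lookup y w ⟧ * sampled y u)

      payoff : Vec Bool n → ℤ
      payoff y = + 4 * b * ⟦ lookup y w ⟧ + (- b * (⟦ lookup y w ⟧ * sampled y v) + - + 2 * spill y)

      good-payoff : ∀ y → payoff y ≤ b * ⟦ good y w v ⟧
      good-payoff y = payoff-bound (λ u → B u v) (A w) (sampled y) Awv (lookup y w)
          (λ p u q → sampled≥1 {y} q p) t>0 dense

      payoff-mean : E.𝔼 payoff ≡ + 4 * b * E.𝔼
          (λ y → ⟦ lookup y w ⟧) + (- b * E.𝔼 (λ y → ⟦ lookup y w ⟧ * sampled y v) + - + 2 * E.𝔼 spill)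
      payoff-mean = trans (E.𝔼-+ (λ y → + 4 * b * ⟦ lookup y w ⟧)
          (λ y → - b * (⟦ lookup y w ⟧ * sampled y v) + - + 2 * spill y))
        (cong₂ _+_ (E.𝔼-* (+ 4 * b) λ y → ⟦ lookup y w ⟧)
          (trans (E.𝔼-+ (λ y → - b * (⟦ lookup y w ⟧ * sampled y v)) (λ y → - + 2 * spill y))
            (cong₂ _+_ (E.𝔼-* (- b) λ y → ⟦ lookup y w ⟧ * sampled y v) (E.𝔼-* (- + 2) spill))))

      spill-mean : E.q * E.q * E.𝔼 spill ≤ b * (m * (s + E.q))
      spill-mean = ≤-trans (≤-reflexive
          (trans (cong (E.q * E.q *_) (trans (E.𝔼-∑ λ u y → g u * (⟦ lookup y w ⟧ * sampled y u))
          (sum-cong-≗ λ u → E.𝔼-* (g u) λ y → ⟦ lookup y w ⟧ * sampled y u)))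
            (trans (sym (∑-*ˡ (E.q * E.q) λ u → g u * E.𝔼 (λ y → ⟦ lookup y w ⟧ * sampled y u)))
                (sum-cong-≗ λ u → swap (E.q * E.q) (g u) _))))
          (≤-trans (∑-mono λ u → scale (⟦⟧≥0 (B u v) ⊗ ⟦⟧≥0 (A w u)) (sampled-mean w u))
              (≤-reflexive (sym (*-distribʳ-sum (m * (s + E.q)) g))))
        where
        g : Fin n → ℤ
        g u = ⟦ B u v ⟧ * ⟦ A w u ⟧
        swap : ∀ a b c → a * (b * c) ≡ b * (a * c)
        swap = solve-∀

      good-mean : m ≤ + 12 * s * E.𝔼 (λ y → ⟦ good y w v ⟧)
      good-mean = mean-arith s>0 b>0 q≡6s at-w above (sampled-mean w v) spill-mean
        where
        above : + 4 * b * E.𝔼 (λ y → ⟦ lookup y w ⟧) + (- b * E.𝔼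
            (λ y → ⟦ lookup y w ⟧ * sampled y v) + - + 2 * E.𝔼 spill) ≤ b * E.𝔼 (λ y → ⟦ good y w v ⟧)
        above = subst₂ _≤_ payoff-mean (E.𝔼-* b λ y → ⟦ good y w v ⟧) (E.𝔼-mono good-payoff)
        at-w : E.q * E.𝔼 {n} (λ y → ⟦ lookup y w ⟧) ≡ m
        at-w = trans (E.𝔼-lookup w ⟦_⟧) (trans (cong (m *_) unit-weight) (*-identityʳ m))

  module _ {H : Relation n} (H⊆A : ∀ {w v} → H w v ≡ true → A w v ≡ true) (H-dense : ∀ {w v} → H w v ≡ true → + 2 * t ≤ codegree w v) where

    good-sample : ∃ λ y → edgeCount H ≤ + 12 * s * edgeCount (good y)
    good-sample = proj₁ attained , ≤-trans (proj₂ attained)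
        (scale (pos≥0 {12} ⊗ s≥0) (∑-mono λ v → ∑-mono λ w → below (H w v) (good (proj₁ attained) w v)))
      where
      below : ∀ a b → ⟦ a ⟧ * ⟦ b ⟧ ≤ ⟦ b ⟧
      below true b = ≤-reflexive (*-identityˡ ⟦ b ⟧)
      below false b = ⟦⟧≥0 b
      wins : Vec Bool n → ℤ
      wins y = ∑ λ v → ∑ λ w → ⟦ H w v ⟧ * ⟦ good y w v ⟧
      each : ∀ v w → m * ⟦ H w v ⟧ ≤ + 12 * s * (⟦ H w v ⟧ * E.𝔼 (λ y → ⟦ good y w v ⟧))
      each v w with H w v in eq
      ... | false = ≤-reflexive (id m s (E.𝔼 λ y → ⟦ good y w v ⟧))
        where
        id : ∀ m s x → m * 0ℤ ≡ + 12 * s * (0ℤ * x)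
        id = solve-∀
      ... | true = subst₂ _≤_ (sym (*-identityʳ m)) (cong (+ 12 * s *_) (sym (*-identityˡ _)))
          (Pair.good-mean (H⊆A eq) (H-dense eq))
      mean : m * edgeCount H ≤ E.𝔼 (λ y → + 12 * s * wins y)
      mean = subst₂ _≤_ (∑∑-*ˡ m λ v w → ⟦ H w v ⟧)
        (trans (∑∑-*ˡ (+ 12 * s) λ v w → ⟦ H w v ⟧ * E.𝔼 (λ y → ⟦ good y w v ⟧))
          (sym (trans (E.𝔼-* (+ 12 * s) wins)
              (cong (+ 12 * s *_) (trans (E.𝔼-∑ λ v y → ∑ λ w → ⟦ H w v ⟧ * ⟦ good y w v ⟧)
            (sum-cong-≗ λ v → trans (E.𝔼-∑ λ w y → ⟦ H w v ⟧ * ⟦ good y w v ⟧)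
                (sum-cong-≗ λ w → E.𝔼-* ⟦ H w v ⟧ λ y → ⟦ good y w v ⟧)))))))
        (∑-mono λ v → ∑-mono (each v))
      attained = E.𝔼-attained (λ y → + 12 * s * wins y) mean

    module _ (y : Vec Bool n) {a K : ℤ} (solution : ∀ w → ∃ λ (b : Fin n → Bool) →
        a * size (atLeast t (restrict B (cluster y w))) ≤ K * - form (restrict B (cluster y w)) (sgn ∘ b) (sgn ∘ b)) where

      private
        Z : Fin n → Fin n → ℤ
        Z w u = ⟦ cluster y w u ⟧ * sgn (proj₁ (solution w) u)

        Z-bounded : ∀ w u → Bounded ⟦ cluster y w u ⟧ (Z w u)
        Z-bounded w u = masked (cluster y w u) (proj₁ (solution w) u)
          where
          masked : ∀ c b → Bounded ⟦ c ⟧ (⟦ c ⟧ * sgn b)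
          masked true b = subst (Bounded 1ℤ) (sym (*-identityˡ (sgn b))) (sgn-bounded b)
          masked false b = ≤-refl , ≤-refl

        piece : 0ℤ ≤ a → ∀ w → a * ∑ (λ v → ⟦ good y w v ⟧) ≤ K * - form B (Z w) (Z w)
        piece a≥0 w = ≤-trans (scale a≥0
            (∑-mono λ v → weaken (cluster y w v) (atLeast t (restrict B (cluster y w)) v)))
          (subst (λ f → a * size (atLeast t (restrict B (cluster y w))) ≤ K * - f)
              (form-restrict B (cluster y w) (sgn ∘ proj₁ (solution w))) (proj₂ (solution w)))
          where
          weaken : ∀ c d → ⟦ c ∧ d ⟧ ≤ ⟦ d ⟧
          weaken true d = ≤-refl
          weaken false d = ⟦⟧≥0 d

      -- The masked solutions have disjoint supports, so their superposition has entries in [-1, 1]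
      -- and is rounded at level 1 without loss.
      combine : Asymmetric B → 0ℤ ≤ a → 0ℤ ≤ K → ∃ λ (b : Fin n → Bool) → a * edgeCount (good y) ≤ K * - form B
          (sgn ∘ b) (sgn ∘ b)
      combine asym a≥0 K≥0 = finish (superpose B n (λ w u → ⟦ cluster y w u ⟧) Z Z-bounded)
        where
        pieces : a * edgeCount (good y) ≤ K * - ∑ (λ w → form B (Z w) (Z w))
        pieces = ≤-trans (≤-reflexive (trans (cong (a *_) (∑-comm λ v w → ⟦ good y w v ⟧))
            (sym (∑-*ˡ a λ w → ∑ λ v → ⟦ good y w v ⟧))))
          (≤-trans (∑-mono (piece a≥0)) (≤-reflexive
              (trans (∑-*ˡ K λ w → - form B (Z w) (Z w)) (cong (K *_) (∑-neg λ w → form B (Z w) (Z w))))))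
        finish : (∃ λ X → (∀ u → Bounded (∑ λ w → ⟦ cluster y w u ⟧) (X u)) × form B X X ≤ ∑ λ w → form B (Z w) (Z w))
            →
          ∃ λ (b : Fin n → Bool) → a * edgeCount (good y) ≤ K * - form B (sgn ∘ b) (sgn ∘ b)
        finish (X , X-bounded , X-form) = round-off (Rounding.round asym pos≥0 X λ u →
            ≤-trans (neg-mono-≤ (cluster-disjoint y u)) (proj₁ (X-bounded u)) , ≤-trans (proj₂ (X-bounded u))
                (cluster-disjoint y u))
          where
          round-off : (∃ λ (b : Fin n → Bool) → 1ℤ * 1ℤ * form B (sgn ∘ b) (sgn ∘ b) ≤ form B X X) →
            ∃ λ (b : Fin n → Bool) → a * edgeCount (good y) ≤ K * - form B (sgn ∘ b) (sgn ∘ b)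
          round-off (b , b-form) = b , ≤-trans pieces
              (scale K≥0 (neg-mono-≤ (≤-trans
              (subst (_≤ form B X X) (*-identityˡ (form B (sgn ∘ b) (sgn ∘ b))) b-form) X-form)))

    many-triangles : Asymmetric B → ∀ {a K} → 0ℤ ≤ a → 0ℤ ≤ K →
      (∀ w S → (∀ {u} → S u ≡ true → A w u ≡ true) → ∃ λ (b : Fin n → Bool) →
        a * size (atLeast t (restrict B S)) ≤ K * - form (restrict B S) (sgn ∘ b) (sgn ∘ b)) →
      ∃ λ (b : Fin n → Bool) → a * edgeCount H ≤ + 12 * s * (K * - form B (sgn ∘ b) (sgn ∘ b))
    many-triangles asym {a} {K} a≥0 K≥0 solution = finish good-sample
      where
      finish : (∃ λ y → edgeCount H ≤ + 12 * s * edgeCount (good y)) → ∃ λ (b : Fin n → Bool) → a * edgeCount H ≤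
          + 12 * s * (K * - form B (sgn ∘ b) (sgn ∘ b))
      finish (y , sample) = scale-up (combine y (λ w → solution w (cluster y w) (proj₁ ∘ ∧-true)) asym a≥0 K≥0)
        where
        id : ∀ a s h g k → + 12 * s * k - a * h ≡ a * (+ 12 * s * g - h) + + 12 * s * (k - a * g)
        id = solve-∀
        scale-up : (∃ λ (b : Fin n → Bool) → a * edgeCount (good y) ≤ K * - form B (sgn ∘ b) (sgn ∘ b)) →
          ∃ λ (b : Fin n → Bool) → a * edgeCount H ≤ + 12 * s * (K * - form B (sgn ∘ b) (sgn ∘ b))
        scale-up (b , p) = b , certify (id a s (edgeCount H) (edgeCount (good y)) (K * - form B (sgn ∘ b) (sgn ∘ b)))
            (a≥0 ⊗ gap sample ⊕ pos≥0 {12} ⊗ s≥0 ⊗ gap p)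

-- Induction on the size of the forbidden tournament

-- Trimming in-neighbourhoods to exactly `s` bounds both the variance of the clipped sums and the
-- number of collisions in the sampling, while keeping `s` pairs for each vertex that counts.
select : (f : Fin n → Bool) (s : ℤ) → 0ℤ ≤ s → s ≤ size f → ∃ λ (g : Fin n → Bool) →
    (∀ {i} → g i ≡ true → f i ≡ true) × size g ≡ s
select {zero} f s 0≤s s≤0 = (λ ()) , (λ {}) , ≤-antisym 0≤s s≤0
select {suc n} f s 0≤s s≤f with f zero in f0 | s ≤? 0ℤ
... | _ | yes s≤0 = (λ _ → false) , (λ ()) , trans (∑-zero {suc n} λ _ → refl) (≤-antisym 0≤s s≤0)
... | false | no _ = let g , g⊆f , eq = select (f ∘ suc) s 0≤s (subst (s ≤_) (+-identityˡ _) s≤f) in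
  (λ { zero → false ; (suc i) → g i }) , (λ { {zero} () ; {suc i} → g⊆f }) , trans (+-identityˡ _) eq
... | true | no s≰0 = let g , g⊆f , eq = select (f ∘ suc) (s - 1ℤ) (gap (i<j⇒suc[i]≤j (≰⇒> s≰0))) (certify (id s (size (f ∘ suc))) (gap s≤f)) in
  (λ { zero → true ; (suc i) → g i }) , (λ { {zero} _ → f0 ; {suc i} → g⊆f }) , trans (+-congˡ 1ℤ eq) (id′ s)
  where
  id : ∀ s x → x - (s - 1ℤ) ≡ 1ℤ + x - s
  id = solve-∀
  id′ : ∀ s → 1ℤ + (s - 1ℤ) ≡ s
  id′ = solve-∀

-- B contains no transitive tournament on j + 2 vertices.
TournamentFree : ℕ → Relation n → Set
TournamentFree zero B = ∀ u v → B u v ≡ false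
TournamentFree (suc j) B = ∀ w → TournamentFree j (restrict B (B w))

TournamentFree-⊆ : ∀ j {B C : Relation n} → (∀ {u v} → C u v ≡ true → B u v ≡ true) → TournamentFree j B →
    TournamentFree j C
TournamentFree-⊆ zero {C = C} C⊆B free u v with C u v in eq
... | false = refl
... | true with trans (sym (C⊆B eq)) (free u v)
...   | ()
TournamentFree-⊆ (suc j) {B} {C} C⊆B free w = TournamentFree-⊆ j (λ {u} {v} p → let c , wc = ∧-true {C u v} p ; wu , wv = ∧-true {C w u} wc in cong₂ _∧_ (C⊆B c) (cong₂ _∧_ (C⊆B wu) (C⊆B wv))) (free w)

^>0 : ∀ {a} → 0ℤ < a → ∀ j → 0ℤ < a ^ j
^>0 a>0 zero = pos>0
^>0 {a} a>0 (suc j) = subst (_< a * a ^ j) (*-zeroʳ a) (*-monoˡ-<-pos a {{positive a>0}} (^>0 a>0 j))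

-- `K` is fixed before the relation and `a`, because one constant must serve all clusters at once
-- and later all dyadic values of `a`.
LargeCut : ℕ → ℤ → Set
LargeCut j K = ∀ {n} (B : Relation n) → Asymmetric B → TournamentFree j B → ∀ {a} → 0ℤ < a →
  ∃ λ (b : Fin n → Bool) → a * size (atLeast (a ^ suc j) B) ≤ K * - form B (sgn ∘ b) (sgn ∘ b)

largeCut : ∀ j → ∃ λ K → 0ℤ < K × LargeCut j K
largeCut zero = 1ℤ , pos>0 , base
  where
  base : LargeCut zero 1ℤ
  -- Without edges every indegree is 0, which is below `a`, so both sides vanish for any partition.
  base {n} B _ empty {a} a>0 = (λ _ → true) , ≤-reflexive
      (trans (cong (a *_) (∑-zero none)) (trans (*-zeroʳ a) (cong (λ x → 1ℤ * - x) (sym form≡0))))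
    where
    form≡0 : form B (λ _ → 1ℤ) (λ _ → 1ℤ) ≡ 0ℤ
    form≡0 = ∑-zero λ u → ∑-zero λ v → cong (λ x → ⟦ x ⟧ * 1ℤ) (empty u v)
    none : ∀ v → ⟦ atLeast (a ^ 1) B v ⟧ ≡ 0ℤ
    none v with a ^ 1 ≤? indegree B v
    ... | no _ = refl
    ... | yes p = ⊥-elim (<⇒≱ (^>0 a>0 1) (subst (a ^ 1 ≤_) (∑-zero λ u → cong ⟦_⟧ (empty u v)) p))
largeCut (suc j) with largeCut j
-- The larger of `H` and `V` contains half of the chosen pairs. The few-triangle bound with
-- `D = 2 t` costs `512 t` and the sampling costs `12 s * K`; doubled, and with the common factors
-- cancelled, they give the two summands.
... | K , K>0 , smaller = + 1024 + + 24 * K , K′>0 , step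
  where
  K≥0 = <⇒≤ K>0
  K′>0 : 0ℤ < + 1024 + + 24 * K
  K′>0 = +-mono-<-≤ {0ℤ} {+ 1024} {0ℤ} pos>0 (pos≥0 {24} ⊗ K≥0)
  step : LargeCut (suc j) (+ 1024 + + 24 * K)
  step {n} B asym free {a} a>0 = conclude (≤-total (edgeCount H) (edgeCount V))
    where
    t s : ℤ
    t = a ^ suc j
    s = a * t
    a≥0 = <⇒≤ a>0
    t>0 = ^>0 a>0 (suc j)
    t≥0 = <⇒≤ t>0
    s>0 = ^>0 a>0 (suc (suc j))
    s≥0 = <⇒≤ s>0
    -- The quotient `t * t / s` is `a ^ j`, at least 1 because `a` is a positive integer.
    s≤64t² : s ≤ + 16 * (+ 2 * t * (+ 2 * t))
    s≤64t² = certify (id a (a ^ j)) (a≥0 ⊗ t≥0 ⊗ gap (i<j⇒suc[i]≤j (^>0 a>0 j)) ⊕ pos≥0 {63} ⊗ (t≥0 ⊗ t≥0))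
      where
      id : ∀ a b → + 16 * (+ 2 * (a * b) * (+ 2 * (a * b))) - a * (a * b) ≡
          a * (a * b) * (b - (1ℤ + 0ℤ)) + + 63 * (a * b * (a * b))
      id = solve-∀
    Pick : Fin n → Set
    Pick v = ∃ λ (g : Fin n → Bool) → (∀ {u} → g u ≡ true → B u v ≡ true) × size g ≤ s × s * ⟦ atLeast s B v ⟧ ≤
        size g
    pick : ∀ v → Pick v
    pick v with s ≤? indegree B v
    ... | yes p = let g , g⊆B , eq = select (λ u → B u v) s s≥0 p in g , g⊆B , ≤-reflexive eq , ≤-reflexive (trans (*-identityʳ s) (sym eq))
    ... | no _ = (λ _ → false) , (λ ()) , ≤-trans (≤-reflexive (∑-zero {n} λ _ → refl)) s≥0 , ≤-reflexive
        (trans (*-zeroʳ s) (sym (∑-zero {n} λ _ → refl)))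
    A : Relation n
    A w v = proj₁ (pick v) w
    A⊆B : ∀ {w v} → A w v ≡ true → B w v ≡ true
    A⊆B {v = v} = proj₁ (proj₂ (pick v))
    A≤s : ∀ v → size (λ w → A w v) ≤ s
    A≤s v = proj₁ (proj₂ (proj₂ (pick v)))
    open Sampling {B = B} {A} {s} {t} A≤s s>0 t>0 using (codegree; many-triangles)
    dense : Relation n
    dense w v = does (+ 2 * t ≤? codegree w v)
    H V : Relation n
    H w v = A w v ∧ dense w v
    V w v = A w v ∧ not (dense w v)
    U = size (atLeast s B)
    edgeCount-A : s * U ≤ edgeCount H + edgeCount V
    edgeCount-A = ≤-trans (≤-reflexive (sym (∑-*ˡ s λ v → ⟦ atLeast s B v ⟧)))
        (≤-trans (∑-mono λ v → proj₂ (proj₂ (proj₂ (pick v))))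
      (≤-reflexive (trans (sum-cong-≗ λ v → sum-cong-≗ λ w → split (A w v) (dense w v))
          (∑∑-distrib-+ (λ v w → ⟦ H w v ⟧) (λ v w → ⟦ V w v ⟧)))))
      where
      split : ∀ x d → ⟦ x ⟧ ≡ ⟦ x ∧ d ⟧ + ⟦ x ∧ not d ⟧
      split true true = refl
      split true false = refl
      split false _ = refl
    Goal = ∃ λ (b : Fin n → Bool) → a * U ≤ (+ 1024 + + 24 * K) * - form B (sgn ∘ b) (sgn ∘ b)
    -- Enlarging the constant is sound because `- φ` is nonnegative, which `p` itself implies, as
    -- `a * U` is.
    weaken : ∀ {c c′ φ} → 0ℤ < c → 0ℤ ≤ c′ → a * U ≤ c * - φ → a * U ≤ (c + c′) * - φ
    weaken {c} {c′} {φ} c>0 c′≥0 p = certify (id c c′ φ (a * U))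
        (gap p ⊕ c′≥0 ⊗ cancel-pos c>0 (subst (_≤ c * - φ) (sym (*-zeroʳ c))
        (≤-trans (a≥0 ⊗ size≥0 (atLeast s B)) p)))
      where
      id : ∀ c c′ φ x → (c + c′) * - φ - x ≡ c * - φ - x + c′ * - φ
      id = solve-∀
    sparse : ∃ λ (b : Fin n → Bool) → edgeCount V ≤ + 256 * (+ 2 * t) * - form B (sgn ∘ b) (sgn ∘ b)
    sparse = few-triangles {B = B} {V} asym (λ {w} {v} p → A⊆B (proj₁ (∧-true {A w v} p))) {s} {+ 2 * t} (λ v → ≤-trans (∑-mono λ w → V≤A w v) (A≤s v)) (*-monoˡ-<-pos (+ 2) t>0) s≤64t² bound
      where
      V≤A : ∀ w v → ⟦ V w v ⟧ ≤ ⟦ A w v ⟧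
      V≤A w v with A w v
      ... | true = ⟦⟧≤1 (not (dense w v))
      ... | false = ≤-refl
      bound : ∀ {w v} → V w v ≡ true → ∑ (λ u → ⟦ B u v ⟧ * ⟦ V w u ⟧) ≤ + 2 * t
      bound {w} {v} p = ≤-trans (∑-mono λ u → scale (⟦⟧≥0 (B u v)) (V≤A w u))
          (sparse-codegree (+ 2 * t ≤? codegree w v) (not-true (proj₂ (∧-true {A w v} p))))
        where
        sparse-codegree : (d : Dec (+ 2 * t ≤ codegree w v)) → does d ≡ false → codegree w v ≤ + 2 * t
        sparse-codegree (no q) _ = <⇒≤ (≰⇒> q)
    rich : ∃ λ (b : Fin n → Bool) → a * edgeCount H ≤ + 12 * s * (K * - form B (sgn ∘ b) (sgn ∘ b))
    rich = many-triangles {H} (λ {w} {v} p → proj₁ (∧-true {A w v} p)) (λ {w} {v} p → dense-codegree (+ 2 * t ≤? codegree w v) (proj₂ (∧-true {A w v} p))) asym a≥0 K≥0 local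
      where
      dense-codegree : ∀ {w v} (d : Dec (+ 2 * t ≤ codegree w v)) → does d ≡ true → + 2 * t ≤ codegree w v
      dense-codegree (yes q) _ = q
      local : ∀ w S → (∀ {u} → S u ≡ true → A w u ≡ true) → ∃ λ (b : Fin n → Bool) →
        a * size (atLeast t (restrict B S)) ≤ K * - form (restrict B S) (sgn ∘ b) (sgn ∘ b)
      local w S S⊆A = smaller (restrict B S) restrict-asym (TournamentFree-⊆ j nested (free w)) a>0
        where
        restrict-asym : Asymmetric (restrict B S)
        restrict-asym u v p rewrite asym u v (proj₁ (∧-true {B u v} p)) = refl
        nested : ∀ {u v} → restrict B S u v ≡ true → restrict B (B w) u v ≡ true
        nested {u} {v} p = let c , q = ∧-true {B u v} p ; su , sv = ∧-true {S u} q in cong₂ _∧_ c (cong₂ _∧_ (A⊆B (S⊆A su)) (A⊆B (S⊆A sv)))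
    conclude : edgeCount H ≤ edgeCount V ⊎ edgeCount V ≤ edgeCount H → Goal
    conclude (inj₁ H≤V) = b , weaken {+ 1024} {+ 24 * K} {form B (sgn ∘ b) (sgn ∘ b)} pos>0 (pos≥0 {24} ⊗ K≥0)
        (cancel-pos t>0
        (certify (id a t U (edgeCount H) (edgeCount V) (form B (sgn ∘ b) (sgn ∘ b)))
            (gap edgeCount-A ⊕ gap H≤V ⊕ pos≥0 {2} ⊗ gap (proj₂ sparse))))
      where
      b = proj₁ sparse
      id : ∀ a t U H V φ → t * (+ 1024 * - φ) - t * (a * U) ≡
          H + V - a * t * U + (V - H) + + 2 * (+ 256 * (+ 2 * t) * - φ - V)
      id = solve-∀
    conclude (inj₂ V≤H) = b , subst (λ c → a * U ≤ c * - φ) (+-comm (+ 24 * K) (+ 1024))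
        (weaken {+ 24 * K} {+ 1024} {φ} (*-monoˡ-<-pos (+ 24) K>0) pos≥0 (cancel-pos s>0
        (certify (id a s U (edgeCount H) (edgeCount V) K φ)
            (a≥0 ⊗ gap edgeCount-A ⊕ a≥0 ⊗ gap V≤H ⊕ pos≥0 {2} ⊗ gap (proj₂ rich)))))
      where
      b = proj₁ rich
      φ = form B (sgn ∘ b) (sgn ∘ b)
      id : ∀ a s U H V K φ → s * (+ 24 * K * - φ) - s * (a * U) ≡
          a * (H + V - s * U) + a * (H - V) + + 2 * (+ 12 * s * (K * - φ) - a * H)
      id = solve-∀

-- Cuts of a graph through its orientations

count-size : (f : Fin n → Bool) → + count f ≡ size f
count-size {zero} f = refl
count-size {suc n} f with f zero
... | true = +-congˡ 1ℤ (count-size (f ∘ suc))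
... | false = +-congˡ 0ℤ (count-size (f ∘ suc))

sumF-∑ : (g : Fin n → ℕ) → + sumF g ≡ ∑ (λ i → + g i)
sumF-∑ {zero} g = refl
sumF-∑ {suc n} g = cong (λ x → + g zero + x) (sumF-∑ (g ∘ suc))

upward : Relation n → Relation n
upward R u v = (toℕ u ℕ.<ᵇ toℕ v) ∧ R u v

countPairs-∑ : (R : Relation n) → + countPairs R ≡ ∑ λ u → ∑ λ v → ⟦ upward R u v ⟧
countPairs-∑ R = trans (sumF-∑ λ u → count (λ v → upward R u v)) (sum-cong-≗ λ u → count-size λ v → upward R u v)

-- A numerical equation packs together that an edge has exactly one direction and a non-edge none,
-- and it can be multiplied and summed directly.
record Orients (O R : Relation n) : Set where
  constructor orients-by
  field
    one-way : ∀ u v → ⟦ O u v ⟧ + ⟦ O v u ⟧ ≡ ⟦ R u v ⟧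
open Orients

Orients-asymmetric : {O R : Relation n} → Orients O R → Asymmetric O
Orients-asymmetric {O = O} {R} orients u v p with O u v | O v u | R u v | one-way orients u v
... | true | false | _ | _ = refl
... | true | true | true | ()
... | true | true | false | ()

Orients-⊆ : {O R : Relation n} → Orients O R → ∀ {u v} → O u v ≡ true → R u v ≡ true
Orients-⊆ {O = O} {R} orients {u} {v} p with O u v | O v u | R u v | one-way orients u v
... | true | _ | true | _ = refl
... | true | true | false | ()
... | true | false | false | ()

upward-orients : (G : Graph n) → Orients (upward (adj G)) (adj G)
upward-orients G = orients-by one
  where
  compare : ∀ i j → i ≢ j → ∀ b → ⟦ (i ℕ.<ᵇ j) ∧ b ⟧ + ⟦ (j ℕ.<ᵇ i) ∧ b ⟧ ≡ ⟦ b ⟧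
  compare zero zero i≢j b = ⊥-elim (i≢j refl)
  compare zero (suc j) _ b = +-identityʳ ⟦ b ⟧
  compare (suc i) zero _ b = +-identityˡ ⟦ b ⟧
  compare (suc i) (suc j) i≢j b = compare i j (i≢j ∘ cong suc) b
  one : ∀ u v → ⟦ upward (adj G) u v ⟧ + ⟦ upward (adj G) v u ⟧ ≡ ⟦ adj G u v ⟧
  one u v with u Fin.≟ v
  ... | yes refl rewrite irrefl G u | Bool.∧-zeroʳ (toℕ u ℕ.<ᵇ toℕ u) = refl
  ... | no u≢v rewrite Graph.sym G v u = compare (toℕ u) (toℕ v) (u≢v ∘ Fin.toℕ-injective) (adj G u v)

-- Twice either side is the sum over ordered adjacent pairs, where the orientation is no longer
-- visible.
orientation-sum : {O O′ R : Relation n} → Orients O R → Orients O′ R → (f : Fin n → Fin n → ℤ) →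
    (∀ u v → f u v ≡ f v u) →
  (∑ λ u → ∑ λ v → ⟦ O u v ⟧ * f u v) ≡ ∑ λ u → ∑ λ v → ⟦ O′ u v ⟧ * f u v
orientation-sum {n} {O} {O′} {R} o o′ f f-sym = *-cancelˡ-≡ (+ 2) _ _ (trans (double o) (sym (double o′)))
  where
  double : {O : Relation n} → Orients O R → + 2 * (∑ λ u → ∑ λ v → ⟦ O u v ⟧ * f u v) ≡ ∑ λ u → ∑ λ v →
      ⟦ R u v ⟧ * f u v
  double {O} o = trans (id (∑ λ u → ∑ λ v → ⟦ O u v ⟧ * f u v))
      (trans (+-congˡ (∑ λ u → ∑ λ v → ⟦ O u v ⟧ * f u v)
      (trans (∑-comm λ u v → ⟦ O u v ⟧ * f u v) (sum-cong-≗ λ u → sum-cong-≗ λ v → cong (⟦ O v u ⟧ *_) (f-sym v u))))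
    (trans (sym (∑∑-distrib-+ (λ u v → ⟦ O u v ⟧ * f u v) (λ u v → ⟦ O v u ⟧ * f u v)))
      (sum-cong-≗ λ u → sum-cong-≗ λ v → trans (sym (*-distribʳ-+ (f u v) ⟦ O u v ⟧ ⟦ O v u ⟧))
          (cong (_* f u v) (one-way o u v)))))
    where
    id : ∀ x → + 2 * x ≡ x + x
    id = solve-∀

edges-∑ : (G : Graph n) {O : Relation n} → Orients O (adj G) → + edges G ≡ edgeCount O
edges-∑ G {O} o = trans (countPairs-∑ (adj G))
    (trans (units (upward (adj G))) (trans (orientation-sum (upward-orients G) o (λ _ _ → 1ℤ) (λ _ _ → refl))
    (trans (sym (units O)) (∑-comm λ u v → ⟦ O u v ⟧))))
  where
  units : (O : Relation _) → (∑ λ u → ∑ λ v → ⟦ O u v ⟧) ≡ ∑ λ u → ∑ λ v → ⟦ O u v ⟧ * 1ℤ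
  units O = sum-cong-≗ λ u → sum-cong-≗ λ v → sym (*-identityʳ ⟦ O u v ⟧)

-- Crossing edges have sign product -1 and the others 1, so both sides are crossing minus
-- non-crossing edges.
cut-form : (G : Graph n) {O : Relation n} → Orients O (adj G) → (P : Fin n → Bool) →
  + 2 * + cut G P - + edges G ≡ - form O (sgn ∘ P) (sgn ∘ P)
cut-form {n} G {O} o P = trans (cong₂ (λ c e → + 2 * c - e) (countPairs-∑ cutting) (countPairs-∑ (adj G)))
  (trans (id₀ (∑ λ u → ∑ λ v → ⟦ upward cutting u v ⟧) (∑ λ u → ∑ λ v → ⟦ upward (adj G) u v ⟧))
      (trans (cong -_ (trans (cong (_+ ∑ λ u → ∑ λ v → ⟦ upward (adj G) u v ⟧)
      (sym (∑∑-*ˡ (- + 2) λ u v → ⟦ upward cutting u v ⟧)))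
    (trans (sym (∑∑-distrib-+ (λ u v → - + 2 * ⟦ upward cutting u v ⟧) (λ u v → ⟦ upward (adj G) u v ⟧)))
      (sum-cong-≗ λ u → sum-cong-≗ λ v → pointwise (toℕ u ℕ.<ᵇ toℕ v) (adj G u v) (P u) (P v)))))
    (cong -_ (orientation-sum (upward-orients G) o (λ u v → sgn (P u) * sgn (P v)) λ u v → *-comm (sgn (P u))
        (sgn (P v))))))
  where
  cutting : Relation n
  cutting u v = adj G u v ∧ (P u xor P v)
  id₀ : ∀ c e → + 2 * c - e ≡ - (- + 2 * c + e)
  id₀ = solve-∀
  pointwise : ∀ l a p q → - + 2 * ⟦ l ∧ (a ∧ (p xor q)) ⟧ + ⟦ l ∧ a ⟧ ≡ ⟦ l ∧ a ⟧ * (sgn p * sgn q)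
  pointwise false a p q = refl
  pointwise true false p q = refl
  pointwise true true true true = refl
  pointwise true true true false = refl
  pointwise true true false true = refl
  pointwise true true false false = refl

count-cong : {f g : Fin n → Bool} → (∀ i → f i ≡ g i) → count f ≡ count g
count-cong {zero} h = refl
count-cong {suc n} h = cong₂ (λ b c → (if b then 1 else 0) ℕ.+ c) (h zero) (count-cong (h ∘ suc))

cut-cong : (G : Graph n) {P P′ : Fin n → Bool} → (∀ u → P u ≡ P′ u) → cut G P ≡ cut G P′
cut-cong {n} G h = sumF-cong λ u → count-cong λ v → cong₂ (λ p q → (toℕ u ℕ.<ᵇ toℕ v) ∧ (adj G u v ∧ (p xor q))) (h u)
    (h v)
  where
  sumF-cong : ∀ {m} {f g : Fin m → ℕ} → (∀ i → f i ≡ g i) → sumF f ≡ sumF g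
  sumF-cong {zero} h = refl
  sumF-cong {suc m} h = cong₂ ℕ._+_ (h zero) (sumF-cong (h ∘ suc))

-- Partitions are functions, so membership in the list is up to pointwise equality; `cut-cong`
-- absorbs the difference.
allParts-complete : (P : Fin n → Bool) → Any (λ P′ → ∀ u → P u ≡ P′ u) (allParts n)
allParts-complete {zero} P = here λ ()
allParts-complete {suc n} P = Any.concatMap⁺ _ (Any.map extend (allParts-complete (P ∘ suc)))
  where
  extend : {P′ : Fin n → Bool} → (∀ u → P (suc u) ≡ P′ u) → _
  extend h with P zero in eq
  ... | false = here λ { zero → eq ; (suc u) → h u }
  ... | true = there (here λ { zero → eq ; (suc u) → h u })

cut≤mc : (G : Graph n) (P : Fin n → Bool) → cut G P ℕ.≤ mc G
cut≤mc {n} G P = bound (allParts n) (allParts-complete P)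
  where
  bound : ∀ Ps → Any (λ P′ → ∀ u → P u ≡ P′ u) Ps → cut G P ℕ.≤ List.foldr ℕ._⊔_ 0 (List.map (cut G) Ps)
  bound (P′ List.∷ Ps) (here h) = ℕ.≤-trans (ℕ.≤-reflexive (cut-cong G h)) (ℕ.m≤m⊔n _ _)
  bound (P′ List.∷ Ps) (there p) = ℕ.≤-trans (bound Ps p) (ℕ.m≤n⊔m (cut G P′) _)

-- Twice sp(G). Truncated subtraction is never below the true difference, which suffices for an
-- upper bound on `- form`.
surplus : Graph n → ℕ
surplus G = 2 ℕ.* mc G ℕ.∸ edges G

form≤surplus : (G : Graph n) {O : Relation n} → Orients O (adj G) → (P : Fin n → Bool) → - form O (sgn ∘ P)
    (sgn ∘ P) ≤ + surplus G
form≤surplus G o P = ≤-trans (≤-reflexive (sym (cut-form G o P)))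
  (≤-trans (+-monoˡ-≤ (- + edges G)
      (≤-trans (≤-reflexive (sym (pos-* 2 (cut G P)))) (+≤+ (ℕ.*-monoʳ-≤ 2 (cut≤mc G P)))))
    (≤-trans (≤-reflexive (m-n≡m⊖n (2 ℕ.* mc G) (edges G))) (truncated (2 ℕ.* mc G) (edges G))))
  where
  truncated : ∀ i j → i ⊖ j ≤ + (i ℕ.∸ j)
  truncated i j with ℕ.≤-total j i
  ... | inj₁ p = ≤-reflexive (⊖-≥ p)
  ... | inj₂ p = ≤-trans (≤-reflexive (⊖-≤ p)) (≤-trans (neg-mono-≤ (pos≥0 {j ℕ.∸ i})) pos≥0)

-- Orientations of degenerate graphs

-- Peel off vertices of degree at most d, orienting their remaining edges towards them.
module _ (G : Graph n) (d : ℕ) (degenerate : Degenerate d G) where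

  private
    inside : (Fin n → Bool) → Relation n
    inside S u v = S u ∧ (S v ∧ adj G u v)

    inside-sym : ∀ S u v → inside S u v ≡ inside S v u
    inside-sym S u v rewrite Graph.sym G u v with S u | S v
    ... | true | true = refl
    ... | true | false = refl
    ... | false | true = refl
    ... | false | false = refl

    subgraph : (S : Fin n → Bool) → Subgraph G
    subgraph S = record
      { S = S
      ; H = inside S
      ; Hsym = inside-sym S
      ; Hsub = λ u v p → proj₂ (∧-true {S v} (proj₂ (∧-true {S u} p)))
      ; Hvert = λ u v p → proj₁ (∧-true {S u} p)
      }

    peel : ∀ k S → size S ≤ + k → ∃ λ O → Orients O (inside S) × ∀ v → indegree O v ≤ + d
    peel k S S≤k with Fin.any? (λ v → S v Bool.≟ true)
    ... | no none = (λ _ _ → false) , orients-by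
        (λ u v → cong ⟦_⟧ (sym (cong (_∧ (S v ∧ adj G u v)) (Bool.¬-not λ p → none (u , p))))) , λ v → ≤-trans
        (≤-reflexive (∑-zero {n} λ _ → refl)) pos≥0
    peel zero S S≤0 | yes (v , Sv) = ⊥-elim
        (<⇒≱ {0ℤ} {1ℤ} pos>0 (≤-trans (subst (λ b → ⟦ b ⟧ ≤ size S) Sv (∑-term (λ i → ⟦⟧≥0 (S i)) v)) S≤0))
    peel (suc k) S S≤k | yes nonempty with degenerate (subgraph S) nonempty
    ... | x , Sx , x-degree = O , orients-by orients , O-indegree
      where
      S′ : Fin n → Bool
      S′ u = S u ∧ not (single x u)
      S′≤k : size S′ ≤ + k
      S′≤k = certify (id (+ k) (size S) (size S′)
          (trans (sum-cong-≗ split) (trans (∑-distrib-+ (λ u → ⟦ S′ u ⟧) (λ u → ⟦ single x u ⟧))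
          (+-congˡ (size S′) (∑-single x))))) (gap S≤k)
        where
        id : ∀ k s s′ → s ≡ s′ + 1ℤ → k - s′ ≡ 1ℤ + k - s
        id k _ s′ refl = id′ k s′
          where
          id′ : ∀ k s′ → k - s′ ≡ 1ℤ + k - (s′ + 1ℤ)
          id′ = solve-∀
        split : ∀ u → ⟦ S u ⟧ ≡ ⟦ S′ u ⟧ + ⟦ single x u ⟧
        split u with x Fin.≟ u
        ... | yes refl rewrite Sx = refl
        ... | no _ = trans (cong ⟦_⟧ (sym (Bool.∧-identityʳ (S u)))) (sym (+-identityʳ _))
      smaller = peel k S′ S′≤k
      O′ = proj₁ smaller
      O′-orients = proj₁ (proj₂ smaller)
      O : Relation n
      O u v = if single x v then inside S u v else O′ u v
      -- In particular `O′` has no edge at the removed vertex `x`, so the edges added towards `x`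
      -- are not directed twice.
      isolated : ∀ u → S′ u ≡ false → ∀ v → O′ u v ≡ false
      isolated u ¬S′u v = zero-summand (O′ u v) (O′ v u)
          (trans (one-way O′-orients u v) (cong (λ b → ⟦ b ∧ (S′ v ∧ adj G u v) ⟧) ¬S′u))
        where
        zero-summand : ∀ a b → ⟦ a ⟧ + ⟦ b ⟧ ≡ 0ℤ → a ≡ false
        zero-summand false _ _ = refl
        zero-summand true true ()
        zero-summand true false ()
      S′x : S′ x ≡ false
      S′x with x Fin.≟ x
      ... | yes _ = Bool.∧-zeroʳ (S x)
      ... | no ¬p = ⊥-elim (¬p refl)
      S′-other : ∀ {u} → x ≢ u → S′ u ≡ S u
      S′-other {u} x≢u with x Fin.≟ u
      ... | yes p = ⊥-elim (x≢u p)
      ... | no _ = Bool.∧-identityʳ (S u)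
      orients : ∀ u v → ⟦ O u v ⟧ + ⟦ O v u ⟧ ≡ ⟦ inside S u v ⟧
      orients u v with x Fin.≟ v | x Fin.≟ u
      ... | yes refl | yes refl = trans (cong (λ b → ⟦ b ⟧ + ⟦ b ⟧) loop) (cong ⟦_⟧ (sym loop))
        where
        loop : inside S x x ≡ false
        loop rewrite irrefl G x | Bool.∧-zeroʳ (S x) = Bool.∧-zeroʳ (S x)
      ... | yes refl | no x≢u = trans (cong (λ b → ⟦ inside S u x ⟧ + ⟦ b ⟧) (isolated x S′x u)) (+-identityʳ _)
      ... | no x≢v | yes refl = trans (cong₂ (λ a b → ⟦ a ⟧ + ⟦ b ⟧) (isolated x S′x v) (inside-sym S v x))
          (+-identityˡ _)
      ... | no x≢v | no x≢u = trans (one-way O′-orients u v)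
          (cong₂ (λ a b → ⟦ a ∧ (b ∧ adj G u v) ⟧) (S′-other x≢u) (S′-other x≢v))
      O-indegree : ∀ v → indegree O v ≤ + d
      O-indegree v with x Fin.≟ v
      ... | yes refl = ≤-trans (≤-reflexive
          (trans (sum-cong-≗ λ u → cong ⟦_⟧ (inside-sym S u x)) (sym (count-size (inside S x))))) (+≤+ x-degree)
      ... | no _ = proj₂ (proj₂ smaller) v

  bounded-orientation : ∃ λ O → Orients O (adj G) × ∀ v → indegree O v ≤ + d
  bounded-orientation = peel n (λ _ → true) (≤-reflexive (whole n))
    where
    whole : ∀ n → size {n} (λ _ → true) ≡ + n
    whole zero = refl
    whole (suc n) = +-congˡ 1ℤ (whole n)

-- From cliques to transitive tournaments

module _ (G : Graph n) where

  private
    Clique : ∀ {m} → (Fin m → Fin n) → Set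
    Clique f = ∀ i j → i ≢ j → adj G (f i) (f j) ≡ true

    Clique-◂ : ∀ {m w} {f : Fin m → Fin n} → (∀ i → adj G w (f i) ≡ true) → Clique f → Clique (w ◂ f)
    Clique-◂ w~f c zero zero i≢j = ⊥-elim (i≢j refl)
    Clique-◂ w~f c zero (suc j) _ = w~f j
    Clique-◂ w~f c (suc i) zero _ = trans (Graph.sym G _ _) (w~f i)
    Clique-◂ w~f c (suc i) (suc j) i≢j = c i j (i≢j ∘ cong suc)

    KrFree⇒¬Clique : ∀ {m} → KrFree m G → (f : Fin m → Fin n) → ¬ Clique f
    KrFree⇒¬Clique free f clique with free f injective
      where
      injective : Injective _≡_ _≡_ f
      injective {i} {j} fi≡fj with i Fin.≟ j
      ... | yes p = p
      ... | no i≢j with trans (sym (clique i j i≢j)) (trans (cong (adj G (f i)) (sym fi≡fj)) (irrefl G (f i)))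
      ...   | ()
    ... | i , j , i≢j , ¬ij with trans (sym (clique i j i≢j)) ¬ij
    ...   | ()

    -- `p` lists the sources removed so far. That `p` is a clique is claimed only in the presence of
    -- an edge of `C`: a new source `w` is known to be adjacent to `p` only if `w` has an
    -- out-neighbour in `C`.
    extending : ∀ j k (p : Fin k → Fin n) (C : Relation n) →
      (∀ {u v} → C u v ≡ true → adj G u v ≡ true × (∀ i → adj G u (p i) ≡ true) ×
          (∀ i → adj G v (p i) ≡ true) × Clique p) →
      (∀ (f : Fin (suc (suc (j ℕ.+ k))) → Fin n) → ¬ Clique f) → TournamentFree j C
    extending zero k p C edge none u v with C u v in eq
    ... | false = refl
    ... | true with edge eq
    ...   | uv , up , vp , c = ⊥-elim (none (u ◂ (v ◂ p)) (Clique-◂ (λ { zero → uv ; (suc i) → up i }) (Clique-◂ vp c)))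
    extending (suc j) k p C edge none w = extending j (suc k) (w ◂ p) (restrict C (C w)) edge′
        (subst (λ m → ∀ (f : Fin (suc (suc m)) → Fin n) → ¬ Clique f) (sym (ℕ.+-suc j k)) none)
      where
      edge′ : ∀ {u v} → restrict C (C w) u v ≡ true → adj G u v ≡ true × (∀ i → adj G u ((w ◂ p) i) ≡ true) ×
          (∀ i → adj G v ((w ◂ p) i) ≡ true) × Clique (w ◂ p)
      edge′ {u} {v} q with ∧-true {C u v} q
      ... | Cuv , r with ∧-true {C w u} r
      ...   | Cwu , Cwv with edge Cuv | edge Cwu | edge Cwv
      ...     | uv , up , vp , c | wu , wp , _ | wv , _ = uv
        , (λ { zero → trans (Graph.sym G u w) wu ; (suc i) → up i })
        , (λ { zero → trans (Graph.sym G v w) wv ; (suc i) → vp i })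
        , Clique-◂ wp c

  KrFree⇒TournamentFree : ∀ j → KrFree (suc (suc j)) G → {O : Relation n} → Orients O (adj G) → TournamentFree j O
  KrFree⇒TournamentFree j free {O} o = extending j 0 (λ ()) O (λ p → Orients-⊆ o p , (λ ()) , (λ ()) , λ ())
    (subst (λ m → ∀ (f : Fin (suc (suc m)) → Fin n) → ¬ Clique f) (sym (ℕ.+-identityʳ j)) (KrFree⇒¬Clique free))

-- Dyadic summation over indegrees

level : ℕ → ℤ
level i = (+ 2) ^ i

levels : ℕ → ℕ → ℤ
levels j zero = 0ℤ
levels j (suc i) = levels j i + level i ^ j

level-suc-^ : ∀ j i → level (suc i) ^ j ≡ (+ 2) ^ j * level i ^ j
level-suc-^ zero i = refl
level-suc-^ (suc j) i = trans (cong (level (suc i) *_) (level-suc-^ j i)) (id (level i) ((+ 2) ^ j) (level i ^ j))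
  where
  id : ∀ l t p → + 2 * l * (t * p) ≡ + 2 * t * (l * p)
  id = solve-∀

level>0 : ∀ i → 0ℤ < level i
level>0 = ^>0 pos>0

-- A value in [level i ^ (j + 1), level (i + 1) ^ (j + 1)) is charged to its lower end.
dyadic-sum : ∀ j {c} (f : Fin n → ℤ) → (∀ v → 0ℤ ≤ f v) →
  (∀ i → level i * ∑ (λ v → ⟦ does (level i ^ suc j ≤? f v) ⟧) ≤ c) →
  ∀ i → (∀ v → f v < level i ^ suc j) → ∑ f ≤ c * (+ 2) ^ suc j * levels j i
dyadic-sum {n} j {c} f f≥0 tail zero small = ≤-trans (∑-mono {g = λ _ → 0ℤ} λ v → below (small v))
    (≤-reflexive (trans (∑-zero {n} λ _ → refl) (sym (*-zeroʳ (c * (+ 2) ^ suc j)))))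
  where
  below : ∀ {x} → x < 1ℤ ^ suc j → x ≤ 0ℤ
  below {x} p = i<1⇒i≤0 (subst (x <_) (^-zeroˡ (suc j)) p)
    where
    i<1⇒i≤0 : ∀ {x} → x < 1ℤ → x ≤ 0ℤ
    i<1⇒i≤0 q = i<j⇒i≤pred[j] q
dyadic-sum {n} j {c} f f≥0 tail (suc i) small =
    certify (id c ((+ 2) ^ j) (level i) (level i ^ j) (levels j i) (∑ f) (∑ low) (∑ λ v → ⟦ high v ⟧))
      (gap (dyadic-sum j low low≥0 low-tail i low-small) ⊕ <⇒≤ (^>0 {+ 2} pos>0 (suc j)) ⊗ <⇒≤
          (^>0 (level>0 i) j) ⊗ gap (tail i) ⊕ gap above)
  where
  T = level i ^ suc j
  T′ = level (suc i) ^ suc j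
  high : Fin n → Bool
  high v = does (T ≤? f v)
  low : Fin n → ℤ
  low v = if high v then 0ℤ else f v
  low≥0 : ∀ v → 0ℤ ≤ low v
  low≥0 v with T ≤? f v
  ... | yes _ = ≤-refl
  ... | no _ = f≥0 v
  low≤f : ∀ v → low v ≤ f v
  low≤f v with T ≤? f v
  ... | yes _ = f≥0 v
  ... | no _ = ≤-refl
  low-small : ∀ v → low v < T
  low-small v with T ≤? f v
  ... | yes _ = ^>0 (level>0 i) (suc j)
  ... | no p = ≰⇒> p
  low-tail : ∀ k → level k * ∑ (λ v → ⟦ does (level k ^ suc j ≤? low v) ⟧) ≤ c
  low-tail k = ≤-trans (scale (<⇒≤ (level>0 k)) (∑-mono λ v → weaken (low≤f v))) (tail k)
    where
    weaken : ∀ {x y} → x ≤ y → ⟦ does (level k ^ suc j ≤? x) ⟧ ≤ ⟦ does (level k ^ suc j ≤? y) ⟧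
    weaken {x} {y} x≤y with level k ^ suc j ≤? x | level k ^ suc j ≤? y
    ... | no _ | d = ⟦⟧≥0 (does d)
    ... | yes _ | yes _ = ≤-refl
    ... | yes p | no ¬q = ⊥-elim (¬q (≤-trans p x≤y))
  split : ∀ v → f v ≤ low v + T′ * ⟦ high v ⟧
  split v with T ≤? f v
  ... | yes _ = subst (f v ≤_) (sym (trans (+-identityˡ _) (*-identityʳ T′))) (<⇒≤ (small v))
  ... | no _ = ≤-reflexive (sym (trans (cong (λ x → f v + x) (*-zeroʳ T′)) (+-identityʳ (f v))))
  above : ∑ f ≤ ∑ low + + 2 * level i * ((+ 2) ^ j * level i ^ j) * ∑ (λ v → ⟦ high v ⟧)
  above = subst (λ p → ∑ f ≤ ∑ low + + 2 * level i * p * ∑ (λ v → ⟦ high v ⟧)) (level-suc-^ j i)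
    (≤-trans (∑-mono split) (≤-reflexive
        (trans (∑-distrib-+ low (λ v → T′ * ⟦ high v ⟧)) (+-congˡ (∑ low) (∑-*ˡ T′ λ v → ⟦ high v ⟧)))))
  id : ∀ c t l p s F L h → c * (+ 2 * t) * (s + p) - F ≡
    c * (+ 2 * t) * s - L + + 2 * t * p * (c - l * h) + (L + + 2 * l * (t * p) * h - F)
  id = solve-∀

-- Consecutive terms grow by a factor of at least 2, so the last one dominates. This needs a
-- positive exponent, which is where `r ≥ 3` enters; with exponent 0 the sum would be the number of
-- levels.
levels-bound : ∀ j i → levels (suc j) (suc i) ≤ + 2 * level i ^ suc j
levels-bound j zero = certify (id (1ℤ ^ suc j)) (<⇒≤ (^>0 {1ℤ} pos>0 (suc j)))
  where
  id : ∀ x → + 2 * x - (0ℤ + x) ≡ x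
  id = solve-∀
levels-bound j (suc i) = certify (id (levels (suc j) (suc i)) (level (suc i) ^ suc j) (level i ^ suc j))
    (gap (levels-bound j i) ⊕ gap doubling)
  where
  id : ∀ s x y → + 2 * x - (s + x) ≡ + 2 * y - s + (x - + 2 * y)
  id = solve-∀
  doubling : + 2 * level i ^ suc j ≤ level (suc i) ^ suc j
  doubling = subst (+ 2 * level i ^ suc j ≤_) (sym (level-suc-^ (suc j) i))
    (certify (id′ ((+ 2) ^ j) (level i ^ suc j))
        (pos≥0 {2} ⊗ gap (i<j⇒suc[i]≤j (^>0 {+ 2} pos>0 j)) ⊗ <⇒≤ (^>0 (level>0 i) (suc j))))
    where
    id′ : ∀ t y → + 2 * t * y - + 2 * y ≡ + 2 * (t - (1ℤ + 0ℤ)) * y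
    id′ = solve-∀

locate : ∀ j d i → 1 ℕ.≤ d → + d < level i ^ suc j → ∃ λ k → level k ^ suc j ≤ + d × + d < level (suc k) ^ suc j
locate j d zero 1≤d d<1 = ⊥-elim (<⇒≱ (subst (+ d <_) (^-zeroˡ (suc j)) d<1) (+≤+ 1≤d))
locate j d (suc i) 1≤d d<l with level i ^ suc j ≤? + d
... | yes p = i , p , d<l
... | no p = locate j d i 1≤d (≰⇒> p)

-- Provides the starting index of the downward search in `locate`, from `d` being less than the
-- `d`-th power of 2.
below-level : ∀ j d → + d < level d ^ suc j
below-level j d = <-≤-trans (exponential d)
    (certify (id (level d) (level d ^ j)) (<⇒≤ (level>0 d) ⊗ gap (i<j⇒suc[i]≤j (^>0 (level>0 d) j))))
  where
  id : ∀ l p → l * p - l ≡ l * (p - (1ℤ + 0ℤ))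
  id = solve-∀
  exponential : ∀ d → + d < level d
  exponential zero = pos>0
  exponential (suc d) = suc[i]≤j⇒i<j
      (certify (id′ (+ d) (level d)) (pos≥0 {2} ⊗ gap (i<j⇒suc[i]≤j (exponential d)) ⊕ pos≥0 {d}))
    where
    id′ : ∀ x l → + 2 * l - (1ℤ + (1ℤ + x)) ≡ + 2 * (l - (1ℤ + x)) + x
    id′ = solve-∀

pos-^ : ∀ m k → + (m ℕ.^ k) ≡ (+ m) ^ k
pos-^ m zero = refl
pos-^ m (suc k) = trans (pos-* m (m ℕ.^ k)) (cong (+ m *_) (pos-^ m k))

*-^ : ∀ x y k → (x ℕ.* y) ℕ.^ k ≡ x ℕ.^ k ℕ.* y ℕ.^ k
*-^ x y zero = refl
*-^ x y (suc k) = trans (cong (x ℕ.* y ℕ.*_) (*-^ x y k)) (id x y (x ℕ.^ k) (y ℕ.^ k))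
  where
  id : ∀ x y p q → x ℕ.* y ℕ.* (p ℕ.* q) ≡ x ℕ.* p ℕ.* (y ℕ.* q)
  id = ℕ-Solver.solve-∀

-- The inequality is cleared of fractional exponents: extracting the root of order `r - 1` gives the
-- claim with the constant `1 / k`.
theorem1p5 : (r : ℕ) → 3 ℕ.≤ r →
    Σ ℕ λ k → 1 ℕ.≤ k ×
    ((n : ℕ) (G : Graph n) (d : ℕ) → 1 ℕ.≤ d → KrFree r G → Degenerate d G →
    (2 ℕ.* edges G) ℕ.^ (r ℕ.∸ 1) ℕ.≤ (k ℕ.* (2 ℕ.* mc G ℕ.∸ edges G)) ℕ.^ (r ℕ.∸ 1) ℕ.* d ℕ.^ (r ℕ.∸ 2))
theorem1p5 (suc (suc (suc j′))) (ℕ.s≤s (ℕ.s≤s (ℕ.s≤s z≤n))) with largeCut (suc j′)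
-- The factor `2 ^ suc j` comes from charging indegrees to the lower end of a dyadic range, one more
-- 2 from the geometric sum, and the outer 2 from doubling the number of edges.
... | + K , K>0 , cuts = 2 ℕ.* (K ℕ.* 2 ℕ.^ suc (suc j)) , constant-positive , bound
  where
  j = suc j′
  κ = K ℕ.* 2 ℕ.^ suc (suc j)
  constant-positive : 1 ℕ.≤ 2 ℕ.* κ
  constant-positive = ℕ.*-mono-≤ (ℕ.s≤s (z≤n {1})) (ℕ.*-mono-≤ (drop‿+<+ K>0) (ℕ.^-monoʳ-≤ 2 {0} {suc (suc j)} z≤n))
  bound : (n : ℕ) (G : Graph n) (d : ℕ) → 1 ℕ.≤ d → KrFree (suc (suc j)) G → Degenerate d G →
    (2 ℕ.* edges G) ℕ.^ suc j ℕ.≤ (2 ℕ.* κ ℕ.* surplus G) ℕ.^ suc j ℕ.* d ℕ.^ j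
  bound n G d 1≤d free degenerate with bounded-orientation G d degenerate | locate j d d 1≤d (below-level j d)
  ... | O , orients , O≤d | i , level≤d , d<level = ℕ.≤-trans (ℕ.^-monoˡ-≤ (suc j) doubled)
        (ℕ.≤-trans (ℕ.≤-reflexive (*-^ (2 ℕ.* κ ℕ.* surplus G) p (suc j)))
            (ℕ.*-monoʳ-≤ ((2 ℕ.* κ ℕ.* surplus G) ℕ.^ suc j) power))
    where
    σ = surplus G
    p = (2 ℕ.^ i) ℕ.^ j
    tail : ∀ k → level k * ∑ (λ v → ⟦ does (level k ^ suc j ≤? indegree O v) ⟧) ≤ + K * + σ
    tail k with cuts O (Orients-asymmetric orients) (KrFree⇒TournamentFree G j free orients) (level>0 k)
    ... | b , q = ≤-trans q (scale (<⇒≤ K>0) (form≤surplus G orients b))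
    edges≤ : + edges G ≤ + (κ ℕ.* σ ℕ.* p)
    edges≤ = ≤-trans (≤-reflexive (edges-∑ G orients)) (≤-trans
      (dyadic-sum j (indegree O) (λ v → size≥0 λ u → O u v) tail (suc i) (λ v → ≤-<-trans (O≤d v) d<level))
      (≤-trans (scale (pos≥0 {K} ⊗ pos≥0 {σ} ⊗ <⇒≤ (^>0 {+ 2} pos>0 (suc j))) (levels-bound j′ i))
          (≤-reflexive (sym rearrange))))
      where
      id : ∀ K t s p → K * (+ 2 * t) * s * p ≡ K * s * t * (+ 2 * p)
      id = solve-∀
      rearrange : + (κ ℕ.* σ ℕ.* p) ≡ + K * + σ * (+ 2) ^ suc j * (+ 2 * level i ^ j)
      rearrange = trans (trans (pos-* (κ ℕ.* σ) p)
          (cong₂ _*_ (trans (pos-* κ σ) (cong (_* + σ)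
          (trans (pos-* K (2 ℕ.^ suc (suc j))) (cong (+ K *_) (pos-^ 2 (suc (suc j)))))))
        (trans (pos-^ (2 ℕ.^ i) j) (cong (_^ j) (pos-^ 2 i))))) (id (+ K) ((+ 2) ^ suc j) (+ σ) (level i ^ j))
    doubled : 2 ℕ.* edges G ℕ.≤ 2 ℕ.* κ ℕ.* σ ℕ.* p
    doubled = ℕ.≤-trans (ℕ.*-monoʳ-≤ 2 (drop‿+≤+ edges≤)) (ℕ.≤-reflexive (id κ σ p))
      where
      id : ∀ k s p → 2 ℕ.* (k ℕ.* s ℕ.* p) ≡ 2 ℕ.* k ℕ.* s ℕ.* p
      id = ℕ-Solver.solve-∀
    -- `p` stands for the power of `d` with exponent `j / (j + 1)`, rounded down to a dyadic level.
    power : p ℕ.^ suc j ℕ.≤ d ℕ.^ j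
    power = ℕ.≤-trans (ℕ.≤-reflexive swap)
        (ℕ.^-monoˡ-≤ j (drop‿+≤+ (≤-trans
        (≤-reflexive (trans (pos-^ (2 ℕ.^ i) (suc j)) (cong (_^ suc j) (pos-^ 2 i)))) level≤d)))
      where
      swap : p ℕ.^ suc j ≡ ((2 ℕ.^ i) ℕ.^ suc j) ℕ.^ j
      swap = trans (ℕ.^-*-assoc (2 ℕ.^ i) j (suc j))
          (trans (cong ((2 ℕ.^ i) ℕ.^_) (ℕ.*-comm j (suc j))) (sym (ℕ.^-*-assoc (2 ℕ.^ i) (suc j) j)))
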